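{- Assume that the following hypothesis (a conjecture of the paper) holds: for every odd integer $m'\geq 3$ there exists a normalized Hadamard matrix of order $4m'$ such that, after deleting its first column and replacing each $-1$ by $0$, some $8$ columns of the resulting OA$(4m',4m'-1,2,2)$ form an OA$(4m',8,2,2)$ that has two subsets $V$ and $W$ of its set of column vectors satisfying (1) $|V|,|W|\geq 3$; (2) there exist ${\bf v}\in V\setminus W$ and ${\bf w}\in W\setminus V$ such that $V\setminus\{{\bf v}\}\neq W\setminus\{{\bf w}\}$; (3) $\sum_{{\bf x}\in V}{\bf x}$ is orthogonal to $\sum_{{\bf y}\in W}{\bf y}$ (sums over $\mathbb{F}_2$). Let $m$ and $b$ be odd positive integers, and let $a\ge 0$ and $k$ be integers. Then an array of type $I_k(4m,2^ab,2,2)$ exists if and only if $(k,4m,2^ab,2,2)$ is admissible and $$(k,4m,2^ab,2,2)\notin\{(3,4c,4,2,2),(3,4,4c,2,2)\mid c \text{ is odd}\}.$$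
   Context: For an integer $s\ge 1$ let $[s]=\{0,1,\dots,s-1\}$. An orthogonal array OA$(n,k,q,t)$ (size $n$, degree $k$, $q$ levels, strength $t$, $1\le t\leq k$) is an $n\times k$ array with entries from $[q]$ such that in every $n\times t$ submatrix (choice of $t$ columns), every vector of $[q]^t$ appears as a row exactly $n/q^t$ times. An array of type $I_k(m,n,q,t)$ (an $m\times n$ row-column factorial design $q^k$ of strength $t$) is an $m\times n$ array whose cells each contain a vector of $[q]^k$ such that: (i) each vector of $[q]^k$ occurs in exactly $\lambda=mn/q^k$ cells (so $q^k\mid mn$); (ii) for each row of the array, the $n$ vectors in that row are the rows of an OA$(n,k,q,t)$; (iii) for each column of the array, the $m$ vectors in that column are the rows of an OA$(m,k,q,t)$. A 5-tuple $(k,m,n,q,t)$ is admissible if $q^k\mid mn$, there exists an OA$(m,k,q,t)$, and there exists an OA$(n,k,q,t)$. A Hadamard matrix of order $n$ is an $n\times n$ matrix $H$ with entries in $\{1,-1\}$ and $HH^T=nI_n$; it is normalized if its first row and first column contain only the entry $1$. Two binary vectors ${\bf v},{\bf w}$ of length $4\ell$ are called orthogonal if each has weight (number of $1$'s) equal to $2\ell$ and the number of positions where both are $1$ is $\ell$. -}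

module Defs where

open import Data.Bool.Base using (if_then_else_)
open import Data.Fin.Base using (Fin; zero; suc; toℕ)
import Data.Fin.Properties as Fin
open import Data.Fin.Subset using (Subset; _∈_; _∉_; _-_; ∣_∣)
open import Data.Fin.Subset.Properties using (_∈?_)
open import Data.Integer.Base as ℤ using (ℤ; +_; 0ℤ; 1ℤ; -1ℤ)
import Data.Integer.Properties as ℤ
open import Data.Nat.Base using (ℕ; zero; suc; pred; _*_; _^_; _≤_)
open import Data.Nat.Divisibility using (_∣_; _∤_)
open import Data.Nat.DivMod using (_mod_)
import Data.Nat.Properties as ℕ
open import Data.Product.Base using (_×_; _,_; Σ-syntax; ∃-syntax)
open import Data.Sum.Base using (_⊎_)
open import Data.Vec.Functional using (Vector; tail)
open import Function.Base using (_∘_)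
open import Function.Definitions using (Injective)
open import Level using (0ℓ)
open import Relation.Binary.PropositionalEquality using (_≡_; _≢_; _≗_)
open import Relation.Nullary.Decidable using (Dec; does; _×-dec_)
open import Relation.Unary using (Pred; Decidable)

open import Algebra.Properties.Semiring.Sum ℕ.+-*-semiring using (sum)
open import Algebra.Properties.Semiring.Sum ℤ.+-*-semiring using () renaming (sum to sumℤ)

private
  variable
    X : Set
    k m n q : ℕ

Odd : ℕ → Set
Odd n = 2 ∤ n

count : {P : Pred (Fin n) 0ℓ} → Decidable P → ℕ
count P? = sum λ i → if does (P? i) then 1 else 0

_≗?_ : (u v : Vector (Fin q) k) → Dec (u ≗ v)
u ≗? v = Fin.all? λ j → u j Fin.≟ v j

Matrix : Set → ℕ → ℕ → Set
Matrix X n k = Fin n → Fin k → X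

selectColumns : Matrix X n k → (Fin m → Fin k) → Matrix X n m
selectColumns A c i = A i ∘ c

-- A choice of t columns is an injection Fin t → Fin k.  "Exactly n / q ^ t times"
-- is written multiplicatively, which also records that q ^ t divides n.
record IsOA (n k q t : ℕ) (A : Matrix (Fin q) n k) : Set where
  field
    1≤t      : 1 ≤ t
    t≤k      : t ≤ k
    balanced : (c : Fin t → Fin k) → Injective _≡_ _≡_ c → (v : Vector (Fin q) t) →
               count (λ i → selectColumns A c i ≗? v) * q ^ t ≡ n

OA : (n k q t : ℕ) → Set
OA n k q t = Σ[ A ∈ Matrix (Fin q) n k ] IsOA n k q t A

record IsFactorialDesign (k m n q t : ℕ) (D : Matrix (Vector (Fin q) k) m n) : Set where
  field
    uniform : (v : Vector (Fin q) k) → sum (λ i → count (λ j → D i j ≗? v)) * q ^ k ≡ m * n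
    rows    : (i : Fin m) → IsOA n k q t (λ j → D i j)
    columns : (j : Fin n) → IsOA m k q t (λ i → D i j)

-- Arrays of type I_k(m,n,q,t).
FactorialDesign : (k m n q t : ℕ) → Set
FactorialDesign k m n q t = Σ[ D ∈ Matrix (Vector (Fin q) k) m n ] IsFactorialDesign k m n q t D

-- Parameter tuples (k , m , n , q , t).
Parameters : Set
Parameters = ℕ × ℕ × ℕ × ℕ × ℕ

Admissible : Pred Parameters 0ℓ
Admissible (k , m , n , q , t) = (q ^ k ∣ m * n) × OA m k q t × OA n k q t

Exceptional : Pred Parameters 0ℓ
Exceptional p = ∃[ c ] Odd c × (p ≡ (3 , 4 * c , 4 , 2 , 2) ⊎ p ≡ (3 , 4 , 4 * c , 2 , 2))

record IsHadamard (n : ℕ) (H : Matrix ℤ n n) : Set where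
  field
    entries : ∀ i j → H i j ≡ 1ℤ ⊎ H i j ≡ -1ℤ
    HHᵀ≡nI  : ∀ i j → sumℤ (λ l → H i l ℤ.* H j l) ≡ (if does (i Fin.≟ j) then + n else 0ℤ)

record IsNormalized (H : Matrix ℤ n n) : Set where
  field
    firstRow    : ∀ i j → toℕ i ≡ 0 → H i j ≡ 1ℤ
    firstColumn : ∀ i j → toℕ j ≡ 0 → H i j ≡ 1ℤ

deleteFirstColumn : Matrix X n k → Matrix X n (pred k)
deleteFirstColumn {k = zero}  A i = λ ()
deleteFirstColumn {k = suc _} A i = tail (A i)

-- Meant for entries ±1: replaces -1 by 0 and keeps 1.
toBit : ℤ → Fin 2
toBit x = if does (x ℤ.≟ -1ℤ) then zero else suc zero

hadamardArray : Matrix ℤ n n → Matrix (Fin 2) n (pred n)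
hadamardArray H i j = toBit (deleteFirstColumn H i j)

weight : Vector (Fin 2) n → ℕ
weight v = count λ i → v i Fin.≟ suc zero

record Orthogonal (ℓ : ℕ) (v w : Vector (Fin 2) (4 * ℓ)) : Set where
  field
    weightˡ : weight v ≡ 2 * ℓ
    weightʳ : weight w ≡ 2 * ℓ
    common  : count (λ i → (v i Fin.≟ suc zero) ×-dec (w i Fin.≟ suc zero)) ≡ ℓ

-- The sum over 𝔽₂ of the columns of A indexed by V.
columnSum : Matrix (Fin 2) n k → Subset k → Vector (Fin 2) n
columnSum A V i = sum (λ j → if does (j ∈? V) then toℕ (A i j) else 0) mod 2

-- Sets of column vectors are given as sets of column indices: the columns of an
-- orthogonal array of strength 2 on two symbols are pairwise distinct, since every
-- pair of them must exhibit the row (0 , 1).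
record IsSuitablePair (ℓ : ℕ) (A : Matrix (Fin 2) (4 * ℓ) k) (V W : Subset k) : Set where
  field
    ∣V∣≥3      : 3 ≤ ∣ V ∣
    ∣W∣≥3      : 3 ≤ ∣ W ∣
    exchange   : ∃[ v ] ∃[ w ] (v ∈ V × v ∉ W) × (w ∈ W × w ∉ V) × V - v ≢ W - w
    orthogonal : Orthogonal ℓ (columnSum A V) (columnSum A W)

HadamardConjecture : Set
HadamardConjecture =
  ∀ ℓ → Odd ℓ → 3 ≤ ℓ →
  Σ[ H ∈ Matrix ℤ (4 * ℓ) (4 * ℓ) ] IsHadamard (4 * ℓ) H × IsNormalized H ×
  (Σ[ c ∈ (Fin 8 → Fin (pred (4 * ℓ))) ] Injective _≡_ _≡_ c ×
   (let A = selectColumns (hadamardArray H) c in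
    IsOA (4 * ℓ) 8 2 2 A × (∃[ V ] ∃[ W ] IsSuitablePair ℓ A V W)))

{-# OPTIONS --safe #-}

-- Non-existence.  The columns of a design 2³ with 4 rows are arrays OA(4,3,2,2), in each of which all rows
-- have the same parity; so all rows of the design have the same triple correlation, and uniformity forces
-- every row to contain the zero vector c/2 times.
--
-- Existence.  Writing bits as signs turns strength 2 into orthogonality of columns, and Parseval gives Rao's
-- bound k < 4m, k < 2^a b as well as the orthogonality of the columns of a Hadamard matrix.  Designs with the
-- same width can be stacked, and 4m = 12 + 8j for odd m ≥ 3, so for k ≤ 7 finitely many designs with 4, 8
-- or 12 rows suffice.  For k ≥ 8 translate k columns of the Hadamard array by the kernel B of the two
-- functionals "sum over V" and "sum over W": condition (3) makes the rows of the array meet the four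
-- cosets of B equally often, while (1) and (2) bound the dual distance of B from below by 3.
module Submission where

open import Defs
open import Data.Bool.Base using (Bool; true; false; if_then_else_; _∧_)
import Data.Bool.Properties as Bool
open import Data.Fin.Base using (Fin; zero; suc; toℕ; splitAt; finToFun; funToFin; punchIn; punchOut; inject≤; fromℕ<)
import Data.Fin.Properties as Fin
open import Data.Fin.Subset using (Subset; _-_; ∣_∣; ⁅_⁆) renaming (_∈_ to _∈ₛ_; _∉_ to _∉ₛ_)
open import Data.Fin.Subset.Properties using (_∈?_; ⊆-antisym; p─q⊆p; x∈p∧x≢y⇒x∈p-y)
open import Data.Integer.Base as ℤ using (ℤ; +_; 0ℤ; 1ℤ; -1ℤ)
import Data.Integer.Properties as ℤ
open import Data.Integer.Tactic.RingSolver using (solve-∀)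
open import Data.Nat.Base as ℕ using (ℕ; zero; suc; _*_; _^_; _≤_; z≤n; s≤s)
open import Data.Nat.DivMod using (_mod_; _/_)
open import Data.Nat.Divisibility using (_∣_; divides; ∣-trans; ∣m∣n⇒∣m+n; m∣m*n; ∣m⇒∣m*n; *-cancelˡ-∣)
open import Data.Nat.Primality using (prime[2]; euclidsLemma)
import Data.Nat.Properties as ℕ
import Data.Nat.Tactic.RingSolver as ℕSolver
open import Data.Product.Base using (_×_; _,_; ∃-syntax; proj₁; proj₂)
open import Data.Sum.Base using (_⊎_; inj₁; inj₂; [_,_]′)
import Data.Vec.Base as Vec
open import Data.Vec.Base using (Vec; lookup) renaming ([] to ⟨⟩; _∷_ to _◂_)
open import Data.Vec.Functional using (Vector; []; _∷_; _++_; head; tail)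
open import Function.Base using (_∘_; id)
open import Function.Bundles using (_⇔_; mk⇔)
open import Function.Definitions using (Injective)
open import Relation.Binary.PropositionalEquality
open import Relation.Nullary.Decidable using (Dec; does; yes; no; from-yes; map′; _×-dec_; _→-dec_; ¬?; dec-true; dec-false)
open import Relation.Nullary.Negation using (¬_; contradiction)
open import Relation.Unary using (_∈_; _∉_)

open import Algebra.Properties.Semiring.Sum ℕ.+-*-semiring as ℕΣ using (sum)
open import Algebra.Properties.Semiring.Sum ℤ.+-*-semiring as ℤΣ using () renaming (sum to sumℤ)

-- Oddness of m and b turns 2 ^ k ∣ 4m * 2 ^ a * b into k ≤ a + 2, so a design with 2 ^ (k - 2)
-- columns, repeated, has the right width. This is the size of a code of codimension 2, hence two
-- functionals. Columns of the large design are translates of the Hadamard columns and keep strength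
-- 2 for free; rows are translates of B, so B itself needs strength 2. The dual of B consists of 0,
-- V, W and their symmetric difference. Condition (1) keeps V and W above weight 2; the symmetric
-- difference contains v and w, and a third element because `V - v` and `W - w` differ. The value k
-- = 7 is a double threshold: Rao's bound allows no more in blocks of 8 rows, and the hypothesis
-- starts with eight columns. For a = 2 the width 4b with b odd is not a multiple of 8 either, so
-- both dimensions have to be cut into pieces of 12 and 8.

private
  variable
    X : Set
    k k′ m m′ n q r s t ℓ K : ℕ

-- Sums and squares

lookup-++-suc : (xs : Vector X (suc m)) (ys : Vector X n) → tail (xs ++ ys) ≗ tail xs ++ ys
lookup-++-suc {m = m} xs ys i with splitAt m i
... | inj₁ _ = refl
... | inj₂ _ = refl

sum-++ : (f : X → ℕ) (xs : Vector X m) (ys : Vector X n) →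
         sum (f ∘ (xs ++ ys)) ≡ sum (f ∘ xs) ℕ.+ sum (f ∘ ys)
sum-++ {m = zero}  f xs ys = refl
sum-++ {m = suc m} f xs ys = begin
  f (head xs) ℕ.+ sum (f ∘ tail (xs ++ ys))             ≡⟨ cong (f (head xs) ℕ.+_) (ℕΣ.sum-cong-≗ (cong f ∘ lookup-++-suc xs ys)) ⟩
  f (head xs) ℕ.+ sum (f ∘ (tail xs ++ ys))             ≡⟨ cong (f (head xs) ℕ.+_) (sum-++ f (tail xs) ys) ⟩
  f (head xs) ℕ.+ (sum (f ∘ tail xs) ℕ.+ sum (f ∘ ys))  ≡⟨ ℕ.+-assoc (f (head xs)) _ _ ⟨
  sum (f ∘ xs) ℕ.+ sum (f ∘ ys)                         ∎
  where open ≡-Reasoning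

sumℤ-++ : (f : X → ℤ) (xs : Vector X m) (ys : Vector X n) →
          sumℤ (f ∘ (xs ++ ys)) ≡ sumℤ (f ∘ xs) ℤ.+ sumℤ (f ∘ ys)
sumℤ-++ {m = zero}  f xs ys = sym (ℤ.+-identityˡ _)
sumℤ-++ {m = suc m} f xs ys = begin
  f (head xs) ℤ.+ sumℤ (f ∘ tail (xs ++ ys))              ≡⟨ cong (ℤ._+_ (f (head xs))) (ℤΣ.sum-cong-≗ (cong f ∘ lookup-++-suc xs ys)) ⟩
  f (head xs) ℤ.+ sumℤ (f ∘ (tail xs ++ ys))              ≡⟨ cong (ℤ._+_ (f (head xs))) (sumℤ-++ f (tail xs) ys) ⟩
  f (head xs) ℤ.+ (sumℤ (f ∘ tail xs) ℤ.+ sumℤ (f ∘ ys))  ≡⟨ ℤ.+-assoc (f (head xs)) _ _ ⟨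
  sumℤ (f ∘ xs) ℤ.+ sumℤ (f ∘ ys)                         ∎
  where open ≡-Reasoning

pos-sum : (f : Vector ℕ n) → + sum f ≡ sumℤ (+_ ∘ f)
pos-sum {zero}  f = refl
pos-sum {suc n} f = trans (ℤ.pos-+ (head f) (sum (tail f))) (cong (ℤ._+_ (+ head f)) (pos-sum (tail f)))

sum-const : ∀ n c → sum {n} (λ _ → c) ≡ n * c
sum-const zero    c = refl
sum-const (suc n) c = cong (c ℕ.+_) (sum-const n c)

sumℤ-const : ∀ n c → sumℤ {n} (λ _ → c) ≡ + n ℤ.* c
sumℤ-const zero    c = sym (ℤ.*-zeroˡ c)
sumℤ-const (suc n) c = begin
  c ℤ.+ sumℤ {n} (λ _ → c)     ≡⟨ cong (ℤ._+_ c) (sumℤ-const n c) ⟩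
  c ℤ.+ + n ℤ.* c              ≡⟨ cong (ℤ._+ + n ℤ.* c) (ℤ.*-identityˡ c) ⟨
  1ℤ ℤ.* c ℤ.+ + n ℤ.* c       ≡⟨ ℤ.*-distribʳ-+ c 1ℤ (+ n) ⟨
  + suc n ℤ.* c                ∎
  where open ≡-Reasoning

sumℤ-scale : ∀ c (f : Vector ℤ n) → sumℤ (λ i → c ℤ.* f i) ≡ c ℤ.* sumℤ f
sumℤ-scale c f = sym (ℤΣ.*-distribˡ-sum c f)

sumℤ-+ : (f g : Vector ℤ n) → sumℤ (λ i → f i ℤ.+ g i) ≡ sumℤ f ℤ.+ sumℤ g
sumℤ-+ = ℤΣ.∑-distrib-+

sumℤ-kronecker : (p : Fin n) (f : Vector ℤ n) (c : ℤ) →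
                 sumℤ (λ q → f q ℤ.* (if does (p Fin.≟ q) then c else 0ℤ)) ≡ f p ℤ.* c
sumℤ-kronecker {suc n} zero f c = begin
  f zero ℤ.* c ℤ.+ sumℤ {n} (λ q → f (suc q) ℤ.* 0ℤ)  ≡⟨ cong (ℤ._+_ (f zero ℤ.* c)) (ℤΣ.sum-cong-≗ (λ q → ℤ.*-zeroʳ (f (suc q)))) ⟩
  f zero ℤ.* c ℤ.+ sumℤ {n} (λ _ → 0ℤ)                ≡⟨ cong (ℤ._+_ (f zero ℤ.* c)) (ℤΣ.sum-replicate-zero n) ⟩
  f zero ℤ.* c ℤ.+ 0ℤ                                 ≡⟨ ℤ.+-identityʳ _ ⟩
  f zero ℤ.* c                                        ∎
  where open ≡-Reasoning
sumℤ-kronecker {suc n} (suc p) f c = begin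
  f zero ℤ.* 0ℤ ℤ.+ sumℤ (λ q → f (suc q) ℤ.* (if does (p Fin.≟ q) then c else 0ℤ))  ≡⟨ cong₂ ℤ._+_ (ℤ.*-zeroʳ (f zero)) (sumℤ-kronecker p (f ∘ suc) c) ⟩
  0ℤ ℤ.+ f (suc p) ℤ.* c                                                             ≡⟨ ℤ.+-identityˡ _ ⟩
  f (suc p) ℤ.* c                                                                    ∎
  where open ≡-Reasoning

square : ℤ → ℤ
square x = x ℤ.* x

square-nonneg : ∀ x → 0ℤ ℤ.≤ square x
square-nonneg (+ x)      = subst (0ℤ ℤ.≤_) (ℤ.pos-* x x) (ℤ.+≤+ z≤n)
square-nonneg ℤ.-[1+ x ] = ℤ.+≤+ z≤n

sum-squares-nonneg : (w : Vector ℤ n) → 0ℤ ℤ.≤ sumℤ (square ∘ w)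
sum-squares-nonneg {zero}  w = ℤ.≤-refl
sum-squares-nonneg {suc n} w = ℤ.+-mono-≤ (square-nonneg (w zero)) (sum-squares-nonneg (w ∘ suc))

square-≤-sum : (w : Vector ℤ n) (i : Fin n) → square (w i) ℤ.≤ sumℤ (square ∘ w)
square-≤-sum w zero =
  subst (ℤ._≤ sumℤ (square ∘ w)) (ℤ.+-identityʳ _) (ℤ.+-monoʳ-≤ (square (w zero)) (sum-squares-nonneg (w ∘ suc)))
square-≤-sum w (suc i) =
  subst (ℤ._≤ sumℤ (square ∘ w)) (ℤ.+-identityˡ _) (ℤ.+-mono-≤ (square-nonneg (w zero)) (square-≤-sum (w ∘ suc) i))

two-squares-≤-sum : (w : Vector ℤ n) {i j : Fin n} → i ≢ j →
                    square (w i) ℤ.+ square (w j) ℤ.≤ sumℤ (square ∘ w)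
two-squares-≤-sum w {zero}  {zero}  i≢j = contradiction refl i≢j
two-squares-≤-sum w {zero}  {suc j} i≢j = ℤ.+-monoʳ-≤ (square (w zero)) (square-≤-sum (w ∘ suc) j)
two-squares-≤-sum w {suc i} {zero}  i≢j =
  subst (ℤ._≤ sumℤ (square ∘ w)) (ℤ.+-comm (square (w zero)) _) (ℤ.+-monoʳ-≤ (square (w zero)) (square-≤-sum (w ∘ suc) i))
two-squares-≤-sum w {suc i} {suc j} i≢j =
  subst (ℤ._≤ sumℤ (square ∘ w)) (ℤ.+-identityˡ _)
    (ℤ.+-mono-≤ (square-nonneg (w zero)) (two-squares-≤-sum (w ∘ suc) (i≢j ∘ cong suc)))

square≡0 : ∀ x → square x ≡ 0ℤ → x ≡ 0ℤ
square≡0 x x²≡0 = [ id , id ]′ (ℤ.i*j≡0⇒i≡0∨j≡0 x x²≡0)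

-- The equality case of `square-≤-sum`: a second square beside that of `w i` has no room left. It is
-- what transposes orthogonality, from columns to rows or back.
sum-squares-concentrated : (w : Vector ℤ n) {i j : Fin n} → i ≢ j →
                           sumℤ (square ∘ w) ≡ square (w i) → w j ≡ 0ℤ
sum-squares-concentrated w {i} {j} i≢j eq = square≡0 (w j) (ℤ.≤-antisym lemma (square-nonneg (w j)))
  where
  cancel : ∀ x y → ℤ.- x ℤ.+ (x ℤ.+ y) ≡ y
  cancel = solve-∀
  lemma : square (w j) ℤ.≤ 0ℤ
  lemma = subst₂ ℤ._≤_ (cancel (square (w i)) (square (w j))) (ℤ.+-inverseˡ (square (w i)))
    (ℤ.+-monoʳ-≤ (ℤ.- square (w i)) (subst (square (w i) ℤ.+ square (w j) ℤ.≤_) eq (two-squares-≤-sum w i≢j)))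

sum-product : (f : Vector ℤ m) (g : Vector ℤ n) →
              sumℤ f ℤ.* sumℤ g ≡ sumℤ (λ p → sumℤ (λ q → f p ℤ.* g q))
sum-product f g = trans (ℤΣ.*-distribʳ-sum (sumℤ g) f) (ℤΣ.sum-cong-≗ λ p → ℤΣ.*-distribˡ-sum (f p) g)

-- Expanding the square leaves only the diagonal terms, each equal to `N` because the coefficients
-- are signs.
parseval : (M : Matrix ℤ n k) (N : ℤ) →
           (∀ p q → sumℤ (λ i → M i p ℤ.* M i q) ≡ (if does (p Fin.≟ q) then N else 0ℤ)) →
           (a : Vector ℤ k) → (∀ p → square (a p) ≡ 1ℤ) →
           sumℤ (λ i → square (sumℤ (λ p → a p ℤ.* M i p))) ≡ + k ℤ.* N
parseval {k = k} M N orth a a²≡1 = begin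
  sumℤ (λ i → square (sumℤ (λ p → a p ℤ.* M i p)))                                ≡⟨ ℤΣ.sum-cong-≗ (λ i → sum-product (λ p → a p ℤ.* M i p) (λ q → a q ℤ.* M i q)) ⟩
  sumℤ (λ i → sumℤ (λ p → sumℤ (λ q → (a p ℤ.* M i p) ℤ.* (a q ℤ.* M i q))))      ≡⟨ ℤΣ.∑-comm (λ i p → sumℤ (λ q → (a p ℤ.* M i p) ℤ.* (a q ℤ.* M i q))) ⟩
  sumℤ (λ p → sumℤ (λ i → sumℤ (λ q → (a p ℤ.* M i p) ℤ.* (a q ℤ.* M i q))))      ≡⟨ ℤΣ.sum-cong-≗ (λ p → ℤΣ.∑-comm (λ i q → (a p ℤ.* M i p) ℤ.* (a q ℤ.* M i q))) ⟩
  sumℤ (λ p → sumℤ (λ q → sumℤ (λ i → (a p ℤ.* M i p) ℤ.* (a q ℤ.* M i q))))      ≡⟨ ℤΣ.sum-cong-≗ (λ p → ℤΣ.sum-cong-≗ (entry p)) ⟩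
  sumℤ (λ p → sumℤ (λ q → (a p ℤ.* a q) ℤ.* (if does (p Fin.≟ q) then N else 0ℤ)))  ≡⟨ ℤΣ.sum-cong-≗ (λ p → sumℤ-kronecker p (λ q → a p ℤ.* a q) N) ⟩
  sumℤ (λ p → square (a p) ℤ.* N)                                                 ≡⟨ ℤΣ.sum-cong-≗ (λ p → trans (cong (ℤ._* N) (a²≡1 p)) (ℤ.*-identityˡ N)) ⟩
  sumℤ {k} (λ _ → N)                                                              ≡⟨ sumℤ-const k N ⟩
  + k ℤ.* N                                                                       ∎
  where
  open ≡-Reasoning
  swap : ∀ x y z w → (x ℤ.* y) ℤ.* (z ℤ.* w) ≡ (x ℤ.* z) ℤ.* (y ℤ.* w)
  swap = solve-∀
  entry : ∀ p q → sumℤ (λ i → (a p ℤ.* M i p) ℤ.* (a q ℤ.* M i q)) ≡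
                  (a p ℤ.* a q) ℤ.* (if does (p Fin.≟ q) then N else 0ℤ)
  entry p q = begin
    sumℤ (λ i → (a p ℤ.* M i p) ℤ.* (a q ℤ.* M i q))  ≡⟨ ℤΣ.sum-cong-≗ (λ i → swap (a p) (M i p) (a q) (M i q)) ⟩
    sumℤ (λ i → (a p ℤ.* a q) ℤ.* (M i p ℤ.* M i q))  ≡⟨ sumℤ-scale (a p ℤ.* a q) (λ i → M i p ℤ.* M i q) ⟩
    (a p ℤ.* a q) ℤ.* sumℤ (λ i → M i p ℤ.* M i q)    ≡⟨ cong ((a p ℤ.* a q) ℤ.*_) (orth p q) ⟩
    (a p ℤ.* a q) ℤ.* (if does (p Fin.≟ q) then N else 0ℤ)  ∎

-- Strength 2 in terms of signs

infixl 6 _⊕_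
_⊕_ : Fin 2 → Fin 2 → Fin 2
zero     ⊕ y        = y
suc zero ⊕ zero     = suc zero
suc zero ⊕ suc zero = zero

-- The nontrivial additive character of 𝔽₂.
χ : Fin 2 → ℤ
χ zero       = 1ℤ
χ (suc zero) = -1ℤ

χ-⊕ : ∀ x y → χ (x ⊕ y) ≡ χ x ℤ.* χ y
χ-⊕ zero       zero       = refl
χ-⊕ zero       (suc zero) = refl
χ-⊕ (suc zero) zero       = refl
χ-⊕ (suc zero) (suc zero) = refl

square-χ : ∀ x → square (χ x) ≡ 1ℤ
square-χ zero       = refl
square-χ (suc zero) = refl

-- The Fourier form of strength 2: character sums of weight 1 and 2 vanish. It quantifies over
-- column indices only, so evaluation decides it.
record Uncorrelated (A : Matrix (Fin 2) n k) : Set where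
  field
    single : ∀ p → sumℤ (λ i → χ (A i p)) ≡ 0ℤ
    pair   : ∀ {p q} → p ≢ q → sumℤ (λ i → χ (A i p) ℤ.* χ (A i q)) ≡ 0ℤ

open Uncorrelated public

indicator : Bool → ℕ
indicator b = if b then 1 else 0

-- Fourier expansion on 𝔽₂². The trailing `∧ true` is what `_≗?_` leaves after two coordinates.
indicator₂ : ∀ (x y a b : Fin 2) →
  + indicator (does (x Fin.≟ a) ∧ (does (y Fin.≟ b) ∧ true)) ℤ.* + 4 ≡
  1ℤ ℤ.+ (χ a ℤ.* χ x ℤ.+ (χ b ℤ.* χ y ℤ.+ χ a ℤ.* χ b ℤ.* (χ x ℤ.* χ y)))
indicator₂ zero       zero       zero       zero       = refl
indicator₂ zero       zero       zero       (suc zero) = refl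
indicator₂ zero       zero       (suc zero) zero       = refl
indicator₂ zero       zero       (suc zero) (suc zero) = refl
indicator₂ zero       (suc zero) zero       zero       = refl
indicator₂ zero       (suc zero) zero       (suc zero) = refl
indicator₂ zero       (suc zero) (suc zero) zero       = refl
indicator₂ zero       (suc zero) (suc zero) (suc zero) = refl
indicator₂ (suc zero) zero       zero       zero       = refl
indicator₂ (suc zero) zero       zero       (suc zero) = refl
indicator₂ (suc zero) zero       (suc zero) zero       = refl
indicator₂ (suc zero) zero       (suc zero) (suc zero) = refl
indicator₂ (suc zero) (suc zero) zero       zero       = refl
indicator₂ (suc zero) (suc zero) zero       (suc zero) = refl
indicator₂ (suc zero) (suc zero) (suc zero) zero       = refl
indicator₂ (suc zero) (suc zero) (suc zero) (suc zero) = refl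

uncorrelated⇒count : (X Y : Vector (Fin 2) n) →
  sumℤ (λ i → χ (X i)) ≡ 0ℤ → sumℤ (λ i → χ (Y i)) ≡ 0ℤ → sumℤ (λ i → χ (X i) ℤ.* χ (Y i)) ≡ 0ℤ →
  ∀ a b → sum (λ i → indicator (does (X i Fin.≟ a) ∧ (does (Y i Fin.≟ b) ∧ true))) * 4 ≡ n
uncorrelated⇒count {n} X Y ΣX ΣY ΣXY a b = ℤ.+-injective (begin
  + (sum I * 4)                                     ≡⟨ ℤ.pos-* (sum I) 4 ⟩
  + sum I ℤ.* + 4                                   ≡⟨ cong (ℤ._* + 4) (pos-sum I) ⟩
  sumℤ (+_ ∘ I) ℤ.* + 4                             ≡⟨ ℤΣ.*-distribʳ-sum (+ 4) (+_ ∘ I) ⟩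
  sumℤ (λ i → + I i ℤ.* + 4)                        ≡⟨ ℤΣ.sum-cong-≗ (λ i → indicator₂ (X i) (Y i) a b) ⟩
  sumℤ (λ i → 1ℤ ℤ.+ (χ a ℤ.* χ (X i) ℤ.+ (χ b ℤ.* χ (Y i) ℤ.+ χ a ℤ.* χ b ℤ.* (χ (X i) ℤ.* χ (Y i)))))
    ≡⟨ sumℤ-+ {n} (λ _ → 1ℤ) _ ⟩
  sumℤ {n} (λ _ → 1ℤ) ℤ.+ sumℤ (λ i → χ a ℤ.* χ (X i) ℤ.+ (χ b ℤ.* χ (Y i) ℤ.+ χ a ℤ.* χ b ℤ.* (χ (X i) ℤ.* χ (Y i))))
    ≡⟨ cong₂ ℤ._+_ (trans (sumℤ-const n 1ℤ) (ℤ.*-identityʳ (+ n))) (trans (sumℤ-+ (λ i → χ a ℤ.* χ (X i)) _)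
         (cong₂ ℤ._+_ (vanish (χ a) ΣX) (trans (sumℤ-+ (λ i → χ b ℤ.* χ (Y i)) _)
           (cong₂ ℤ._+_ (vanish (χ b) ΣY) (vanish (χ a ℤ.* χ b) ΣXY))))) ⟩
  + n ℤ.+ 0ℤ                                        ≡⟨ ℤ.+-identityʳ (+ n) ⟩
  + n                                               ∎)
  where
  open ≡-Reasoning
  I : Vector ℕ n
  I i = indicator (does (X i Fin.≟ a) ∧ (does (Y i Fin.≟ b) ∧ true))
  vanish : ∀ c {f : Vector ℤ n} → sumℤ f ≡ 0ℤ → sumℤ (λ i → c ℤ.* f i) ≡ 0ℤ
  vanish c {f} Σf≡0 = trans (sumℤ-scale c f) (trans (cong (c ℤ.*_) Σf≡0) (ℤ.*-zeroʳ c))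

uncorrelated⇒isOA : {A : Matrix (Fin 2) n k} → 2 ≤ k → Uncorrelated A → IsOA n k 2 2 A
uncorrelated⇒isOA {A = A} 2≤k u = record
  { 1≤t      = s≤s z≤n
  ; t≤k      = 2≤k
  ; balanced = λ c inj v → uncorrelated⇒count (λ i → A i (c zero)) (λ i → A i (c (suc zero)))
      (single u _) (single u _) (pair u (λ c₀≡c₁ → contradiction (inj c₀≡c₁) λ ())) (v zero) (v (suc zero))
  }

private
  combination : (f : Fin 2 → Fin 2 → ℤ) (x y : Fin 2) → let I = λ a b → + indicator (does (x Fin.≟ a) ∧ (does (y Fin.≟ b) ∧ true)) in
    f x y ≡ f zero zero ℤ.* I zero zero ℤ.+ (f zero (suc zero) ℤ.* I zero (suc zero) ℤ.+
            (f (suc zero) zero ℤ.* I (suc zero) zero ℤ.+ f (suc zero) (suc zero) ℤ.* I (suc zero) (suc zero)))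
  combination f zero       zero       = only (f zero zero) (f zero (suc zero)) (f (suc zero) zero) (f (suc zero) (suc zero))
    where
    only : ∀ a b c d → a ≡ a ℤ.* 1ℤ ℤ.+ (b ℤ.* 0ℤ ℤ.+ (c ℤ.* 0ℤ ℤ.+ d ℤ.* 0ℤ))
    only = solve-∀
  combination f zero       (suc zero) = only (f zero zero) (f zero (suc zero)) (f (suc zero) zero) (f (suc zero) (suc zero))
    where
    only : ∀ a b c d → b ≡ a ℤ.* 0ℤ ℤ.+ (b ℤ.* 1ℤ ℤ.+ (c ℤ.* 0ℤ ℤ.+ d ℤ.* 0ℤ))
    only = solve-∀
  combination f (suc zero) zero       = only (f zero zero) (f zero (suc zero)) (f (suc zero) zero) (f (suc zero) (suc zero))
    where
    only : ∀ a b c d → c ≡ a ℤ.* 0ℤ ℤ.+ (b ℤ.* 0ℤ ℤ.+ (c ℤ.* 1ℤ ℤ.+ d ℤ.* 0ℤ))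
    only = solve-∀
  combination f (suc zero) (suc zero) = only (f zero zero) (f zero (suc zero)) (f (suc zero) zero) (f (suc zero) (suc zero))
    where
    only : ∀ a b c d → d ≡ a ℤ.* 0ℤ ℤ.+ (b ℤ.* 0ℤ ℤ.+ (c ℤ.* 0ℤ ℤ.+ d ℤ.* 1ℤ))
    only = solve-∀

-- All four pairs occur equally often, so the sum is this common frequency times the sum of the four
-- values of `f`.
isOA⇒sum : {A : Matrix (Fin 2) n k} → IsOA n k 2 2 A → ∀ {p q} → p ≢ q → (f : Fin 2 → Fin 2 → ℤ) →
  f zero zero ℤ.+ (f zero (suc zero) ℤ.+ (f (suc zero) zero ℤ.+ f (suc zero) (suc zero))) ≡ 0ℤ →
  sumℤ (λ i → f (A i p) (A i q)) ≡ 0ℤ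
isOA⇒sum {n} {k} {A} oa {p} {q} p≢q f Σf≡0 = begin
  sumℤ (λ i → f (A i p) (A i q))
    ≡⟨ ℤΣ.sum-cong-≗ (λ i → combination f (A i p) (A i q)) ⟩
  sumℤ (λ i → f₀₀ ℤ.* I zero zero i ℤ.+ (f₀₁ ℤ.* I zero (suc zero) i ℤ.+ (f₁₀ ℤ.* I (suc zero) zero i ℤ.+ f₁₁ ℤ.* I (suc zero) (suc zero) i)))
    ≡⟨ trans (sumℤ-+ (λ i → f₀₀ ℤ.* I zero zero i) _) (cong₂ ℤ._+_ (scaled f₀₀ zero zero)
       (trans (sumℤ-+ (λ i → f₀₁ ℤ.* I zero (suc zero) i) _) (cong₂ ℤ._+_ (scaled f₀₁ zero (suc zero))
       (trans (sumℤ-+ (λ i → f₁₀ ℤ.* I (suc zero) zero i) _) (cong₂ ℤ._+_ (scaled f₁₀ (suc zero) zero) (scaled f₁₁ (suc zero) (suc zero))))))) ⟩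
  f₀₀ ℤ.* + N ℤ.+ (f₀₁ ℤ.* + N ℤ.+ (f₁₀ ℤ.* + N ℤ.+ f₁₁ ℤ.* + N))
    ≡⟨ factor f₀₀ f₀₁ f₁₀ f₁₁ (+ N) ⟩
  (f₀₀ ℤ.+ (f₀₁ ℤ.+ (f₁₀ ℤ.+ f₁₁))) ℤ.* + N
    ≡⟨ cong (ℤ._* + N) Σf≡0 ⟩
  0ℤ ∎
  where
  open ≡-Reasoning
  f₀₀ = f zero zero
  f₀₁ = f zero (suc zero)
  f₁₀ = f (suc zero) zero
  f₁₁ = f (suc zero) (suc zero)
  I′ : Fin 2 → Fin 2 → Vector ℕ n
  I′ a b i = indicator (does (A i p Fin.≟ a) ∧ (does (A i q Fin.≟ b) ∧ true))
  I : Fin 2 → Fin 2 → Vector ℤ n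
  I a b i = + I′ a b i
  N = sum (I′ zero zero)
  columns : Fin 2 → Fin k
  columns = p ∷ q ∷ []
  columns-injective : Injective _≡_ _≡_ columns
  columns-injective {zero}     {zero}     _   = refl
  columns-injective {zero}     {suc zero} p≡q = contradiction p≡q p≢q
  columns-injective {suc zero} {zero}     q≡p = contradiction (sym q≡p) p≢q
  columns-injective {suc zero} {suc zero} _   = refl
  frequency : ∀ a b → sum (I′ a b) * 4 ≡ n
  frequency a b = IsOA.balanced oa columns columns-injective (a ∷ b ∷ [])
  scaled : ∀ c a b → sumℤ (λ i → c ℤ.* I a b i) ≡ c ℤ.* + N
  scaled c a b = trans (sumℤ-scale c (I a b)) (cong (c ℤ.*_) (trans (sym (pos-sum (I′ a b)))
    (cong +_ (ℕ.*-cancelʳ-≡ (sum (I′ a b)) N 4 (trans (frequency a b) (sym (frequency zero zero)))))))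
  factor : ∀ a b c d N → a ℤ.* N ℤ.+ (b ℤ.* N ℤ.+ (c ℤ.* N ℤ.+ d ℤ.* N)) ≡ (a ℤ.+ (b ℤ.+ (c ℤ.+ d))) ℤ.* N
  factor = solve-∀

other : 2 ≤ k → (p : Fin k) → ∃[ q ] p ≢ q
other (s≤s (s≤s _)) zero    = suc zero , λ ()
other (s≤s (s≤s _)) (suc p) = zero , λ ()

isOA⇒uncorrelated : {A : Matrix (Fin 2) n k} → IsOA n k 2 2 A → Uncorrelated A
isOA⇒uncorrelated oa = record
  -- Strength 2 speaks of pairs only, so a second column is borrowed and then ignored by the
  -- summand.
  { single = λ p → isOA⇒sum oa (proj₂ (other (IsOA.t≤k oa) p)) (λ x _ → χ x) refl
  ; pair   = λ p≢q → isOA⇒sum oa p≢q (λ x y → χ x ℤ.* χ y) refl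
  }

-- The constant column makes weight 1 sums into inner products: degree k gives k + 1 pairwise
-- orthogonal sign columns.
signRow : Vector (Fin 2) k → Vector ℤ (suc k)
signRow u = 1ℤ ∷ χ ∘ u

square-signRow : (u : Vector (Fin 2) k) → ∀ p → square (signRow u p) ≡ 1ℤ
square-signRow u zero    = refl
square-signRow u (suc p) = square-χ (u p)

signRows-orthogonal : {A : Matrix (Fin 2) n k} → Uncorrelated A → ∀ p q →
  sumℤ (λ i → signRow (A i) p ℤ.* signRow (A i) q) ≡ (if does (p Fin.≟ q) then + n else 0ℤ)
signRows-orthogonal {n} {A = A} u p q with p Fin.≟ q
... | yes refl = trans (ℤΣ.sum-cong-≗ (λ i → square-signRow (A i) p)) (trans (sumℤ-const n 1ℤ) (ℤ.*-identityʳ (+ n)))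
signRows-orthogonal u zero    zero    | no 0≢0 = contradiction refl 0≢0
signRows-orthogonal {A = A} u zero    (suc q) | no _ = trans (ℤΣ.sum-cong-≗ (λ i → ℤ.*-identityˡ (χ (A i q)))) (single u q)
signRows-orthogonal {A = A} u (suc p) zero    | no _ = trans (ℤΣ.sum-cong-≗ (λ i → ℤ.*-identityʳ (χ (A i p)))) (single u p)
signRows-orthogonal u (suc p) (suc q) | no p≢q = pair u (p≢q ∘ cong suc)

correlation : Matrix (Fin 2) n k → Fin n → Fin n → ℤ
correlation A i j = sumℤ (λ p → signRow (A i) p ℤ.* signRow (A j) p)

correlation-self : (A : Matrix (Fin 2) n k) (i : Fin n) → correlation A i i ≡ + suc k
correlation-self {k = k} A i =
  trans (ℤΣ.sum-cong-≗ (square-signRow (A i))) (trans (sumℤ-const (suc k) 1ℤ) (ℤ.*-identityʳ (+ suc k)))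

sum-correlation² : {A : Matrix (Fin 2) n k} → Uncorrelated A → ∀ i →
                   sumℤ (λ j → square (correlation A i j)) ≡ + (suc k * n)
sum-correlation² {n} {k} {A} u i =
  trans (parseval (signRow ∘ A) (+ n) (signRows-orthogonal u) (signRow (A i)) (square-signRow (A i))) (sym (ℤ.pos-* (suc k) n))

-- Rao's bound: the squared correlations with a fixed row sum to (k + 1) n, and the row itself contributes (k + 1)².
degree<size : {A : Matrix (Fin 2) n k} → Uncorrelated A → Fin n → k ℕ.< n
degree<size {n} {k} {A} u i = ℕ.*-cancelˡ-≤ (suc k) (ℤ.drop‿+≤+ (subst₂ ℤ._≤_
  (trans (cong square (correlation-self A i)) (sym (ℤ.pos-* (suc k) (suc k))))
  (sum-correlation² u i) (square-≤-sum (correlation A i) i)))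

-- With k + 1 rows the correlation of a row with itself already exhausts the sum of squares. The
-- sign matrix is then Hadamard.
saturated⇒correlation≡0 : {A : Matrix (Fin 2) (suc k) k} → Uncorrelated A → ∀ {i j} → i ≢ j → correlation A i j ≡ 0ℤ
saturated⇒correlation≡0 {k} {A} u {i} i≢j = sum-squares-concentrated (correlation A i) i≢j (trans (sum-correlation² u i)
  (trans (ℤ.pos-* (suc k) (suc k)) (cong square (sym (correlation-self A i)))))

-- Operations on designs

All-++ : (P : X → Set) (xs : Vector X m) (ys : Vector X n) →
         (∀ i → P (xs i)) → (∀ i → P (ys i)) → ∀ i → P ((xs ++ ys) i)
All-++ {m = m} P xs ys all-xs all-ys i with splitAt m i
... | inj₁ j = all-xs j
... | inj₂ j = all-ys j

isOA-selectColumns : {A : Matrix (Fin q) n k} (ι : Fin k′ → Fin k) → Injective _≡_ _≡_ ι → t ≤ k′ →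
                     IsOA n k q t A → IsOA n k′ q t (selectColumns A ι)
isOA-selectColumns ι inj t≤k′ oa = record
  { 1≤t      = IsOA.1≤t oa
  ; t≤k      = t≤k′
  ; balanced = λ c c-inj v → IsOA.balanced oa (ι ∘ c) (c-inj ∘ inj) v
  }

isOA-++ : {A : Matrix (Fin q) m k} {B : Matrix (Fin q) n k} →
          IsOA m k q t A → IsOA n k q t B → IsOA (m ℕ.+ n) k q t (A ++ B)
isOA-++ {q} {m} {n = n} {t = t} {A} {B} oaA oaB = record
  { 1≤t      = IsOA.1≤t oaA
  ; t≤k      = IsOA.t≤k oaA
  ; balanced = λ c inj v → begin
      count (λ i → selectColumns (A ++ B) c i ≗? v) * q ^ t
        ≡⟨ cong (_* q ^ t) (sum-++ (λ u → indicator (does ((u ∘ c) ≗? v))) A B) ⟩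
      (count (λ i → selectColumns A c i ≗? v) ℕ.+ count (λ i → selectColumns B c i ≗? v)) * q ^ t
        ≡⟨ ℕ.*-distribʳ-+ (q ^ t) (count (λ i → selectColumns A c i ≗? v)) _ ⟩
      count (λ i → selectColumns A c i ≗? v) * q ^ t ℕ.+ count (λ i → selectColumns B c i ≗? v) * q ^ t
        ≡⟨ cong₂ ℕ._+_ (IsOA.balanced oaA c inj v) (IsOA.balanced oaB c inj v) ⟩
      m ℕ.+ n ∎
  }
  where open ≡-Reasoning

isOA-cong : {A B : Matrix (Fin q) n k} → (∀ i → A i ≡ B i) → IsOA n k q t A → IsOA n k q t B
isOA-cong {q = q} {t = t} A≡B oa = record
  { 1≤t      = IsOA.1≤t oa
  ; t≤k      = IsOA.t≤k oa
  ; balanced = λ c inj v → trans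
      (cong (_* q ^ t) (ℕΣ.sum-cong-≗ (λ i → cong (λ u → indicator (does ((u ∘ c) ≗? v))) (sym (A≡B i)))))
      (IsOA.balanced oa c inj v)
  }

lookup-++-at : (D : Matrix X m k) (E : Matrix X n k) (j : Fin k) → ∀ i →
               ((λ i → D i j) ++ (λ i → E i j)) i ≡ (D ++ E) i j
lookup-++-at {m = m} D E j i with splitAt m i
... | inj₁ _ = refl
... | inj₂ _ = refl

transposed : FactorialDesign k m n q t → FactorialDesign k n m q t
transposed {k} {m} {n} {q} (D , d) = (λ j i → D i j) , record
  { uniform = λ v → trans (cong (_* q ^ k) (ℕΣ.∑-comm (λ j i → indicator (does (D i j ≗? v)))))
      (trans (IsFactorialDesign.uniform d v) (ℕ.*-comm m n))
  ; rows    = IsFactorialDesign.columns d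
  ; columns = IsFactorialDesign.rows d
  }

stacked : FactorialDesign k m n q t → FactorialDesign k m′ n q t → FactorialDesign k (m ℕ.+ m′) n q t
stacked {k} {m} {n} {q} {t} {m′} (D , d) (E , e) = D ++ E , record
  { uniform = λ v → begin
      sum (λ i → count (λ j → (D ++ E) i j ≗? v)) * q ^ k
        ≡⟨ cong (_* q ^ k) (sum-++ (λ row → count (λ j → row j ≗? v)) D E) ⟩
      (sum (λ i → count (λ j → D i j ≗? v)) ℕ.+ sum (λ i → count (λ j → E i j ≗? v))) * q ^ k
        ≡⟨ ℕ.*-distribʳ-+ (q ^ k) (sum (λ i → count (λ j → D i j ≗? v))) _ ⟩
      sum (λ i → count (λ j → D i j ≗? v)) * q ^ k ℕ.+ sum (λ i → count (λ j → E i j ≗? v)) * q ^ k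
        ≡⟨ cong₂ ℕ._+_ (IsFactorialDesign.uniform d v) (IsFactorialDesign.uniform e v) ⟩
      m * n ℕ.+ m′ * n
        ≡⟨ ℕ.*-distribʳ-+ n m m′ ⟨
      (m ℕ.+ m′) * n ∎
  ; rows    = All-++ (IsOA n k q t) D E (IsFactorialDesign.rows d) (IsFactorialDesign.rows e)
  ; columns = λ j → isOA-cong (lookup-++-at D E j)
      (isOA-++ (IsFactorialDesign.columns d j) (IsFactorialDesign.columns e j))
  }
  where open ≡-Reasoning

repeated : ∀ c → FactorialDesign k m n q t → FactorialDesign k (suc c * m) n q t
repeated {k} {m} {n} {q} {t} zero    D = subst (λ m → FactorialDesign k m n q t) (sym (ℕ.+-identityʳ m)) D
repeated                     (suc c) D = stacked D (repeated c D)

does-≗?-cong : ∀ k {u u′ v : Vector (Fin q) k} → u ≗ u′ → does (u ≗? v) ≡ does (u′ ≗? v)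
does-≗?-cong zero    u≗u′ = refl
does-≗?-cong (suc k) {v = v} u≗u′ =
  cong₂ _∧_ (cong (λ x → does (x Fin.≟ v zero)) (u≗u′ zero)) (does-≗?-cong k (u≗u′ ∘ suc))

private
  indicator-∧ : ∀ (x : Fin 2) b → indicator b ≡
    indicator (does (x Fin.≟ zero) ∧ b) ℕ.+ indicator (does (x Fin.≟ suc zero) ∧ b)
  indicator-∧ zero       b = sym (ℕ.+-identityʳ _)
  indicator-∧ (suc zero) b = refl

-- Every vector has two extensions by a first bit, both equally frequent. The uniformity equation is
-- doubled so that 2 ^ `suc k` appears.
withoutFirstFactor : t ≤ k → FactorialDesign (suc k) m n 2 t → FactorialDesign k m n 2 t
withoutFirstFactor {t} {k} {m} {n} t≤k (D , d) = (λ i j → tail (D i j)) , record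
  { uniform = λ v → ℕ.*-cancelʳ-≡ _ _ 2 (begin
      sum (λ i → count (λ j → tail (D i j) ≗? v)) * 2 ^ k * 2
        ≡⟨ cong (λ s → s * 2 ^ k * 2) (split v) ⟩
      (frequency (zero ∷ v) ℕ.+ frequency (suc zero ∷ v)) * 2 ^ k * 2
        ≡⟨ regroup (frequency (zero ∷ v)) (frequency (suc zero ∷ v)) (2 ^ k) ⟩
      frequency (zero ∷ v) * 2 ^ suc k ℕ.+ frequency (suc zero ∷ v) * 2 ^ suc k
        ≡⟨ cong₂ ℕ._+_ (IsFactorialDesign.uniform d (zero ∷ v)) (IsFactorialDesign.uniform d (suc zero ∷ v)) ⟩
      m * n ℕ.+ m * n
        ≡⟨ double (m * n) ⟩
      m * n * 2 ∎)
  ; rows    = λ i → isOA-selectColumns suc Fin.suc-injective t≤k (IsFactorialDesign.rows d i)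
  ; columns = λ j → isOA-selectColumns suc Fin.suc-injective t≤k (IsFactorialDesign.columns d j)
  }
  where
  open ≡-Reasoning
  frequency : Vector (Fin 2) (suc k) → ℕ
  frequency v = sum (λ i → count (λ j → D i j ≗? v))
  split : ∀ v → sum (λ i → count (λ j → tail (D i j) ≗? v)) ≡ frequency (zero ∷ v) ℕ.+ frequency (suc zero ∷ v)
  split v = trans
    (ℕΣ.sum-cong-≗ (λ i → trans (ℕΣ.sum-cong-≗ (λ j → indicator-∧ (head (D i j)) (does (tail (D i j) ≗? v))))
      (ℕΣ.∑-distrib-+ (λ j → indicator (does (D i j ≗? (zero ∷ v)))) _)))
    (ℕΣ.∑-distrib-+ (λ i → count (λ j → D i j ≗? (zero ∷ v))) _)
  regroup : ∀ a b c → (a ℕ.+ b) * c * 2 ≡ a * (2 * c) ℕ.+ b * (2 * c)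
  regroup = ℕSolver.solve-∀
  double : ∀ a → a ℕ.+ a ≡ a * 2
  double = ℕSolver.solve-∀

uncorrelated-selectColumns : {A : Matrix (Fin 2) n k} {ι : Fin k′ → Fin k} → Injective _≡_ _≡_ ι →
                             Uncorrelated A → Uncorrelated (selectColumns A ι)
uncorrelated-selectColumns {ι = ι} inj u = record
  { single = λ p → single u (ι p)
  ; pair   = λ p≢q → pair u (p≢q ∘ inj)
  }

uncorrelated-cong : {A B : Matrix (Fin 2) n k} → (∀ i p → A i p ≡ B i p) → Uncorrelated A → Uncorrelated B
uncorrelated-cong A≡B u = record
  { single = λ p → trans (ℤΣ.sum-cong-≗ (λ i → cong χ (sym (A≡B i p)))) (single u p)
  ; pair   = λ {p} {q} p≢q → trans
      (ℤΣ.sum-cong-≗ (λ i → cong₂ (λ x y → χ x ℤ.* χ y) (sym (A≡B i p)) (sym (A≡B i q)))) (pair u p≢q)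
  }

-- Translation multiplies each character sum by a sign.
uncorrelated-⊕ : {A : Matrix (Fin 2) n k} → Uncorrelated A → (c : Vector (Fin 2) k) →
                 Uncorrelated (λ i p → A i p ⊕ c p)
uncorrelated-⊕ {A = A} u c = record
  { single = λ p → begin
      sumℤ (λ i → χ (A i p ⊕ c p))            ≡⟨ ℤΣ.sum-cong-≗ (λ i → trans (χ-⊕ (A i p) (c p)) (ℤ.*-comm (χ (A i p)) (χ (c p)))) ⟩
      sumℤ (λ i → χ (c p) ℤ.* χ (A i p))      ≡⟨ sumℤ-scale (χ (c p)) (λ i → χ (A i p)) ⟩
      χ (c p) ℤ.* sumℤ (λ i → χ (A i p))      ≡⟨ cong (χ (c p) ℤ.*_) (single u p) ⟩
      χ (c p) ℤ.* 0ℤ                          ≡⟨ ℤ.*-zeroʳ (χ (c p)) ⟩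
      0ℤ                                      ∎
  ; pair   = λ {p} {q} p≢q → begin
      sumℤ (λ i → χ (A i p ⊕ c p) ℤ.* χ (A i q ⊕ c q))
        ≡⟨ ℤΣ.sum-cong-≗ (λ i → trans (cong₂ ℤ._*_ (χ-⊕ (A i p) (c p)) (χ-⊕ (A i q) (c q)))
             (regroup (χ (A i p)) (χ (c p)) (χ (A i q)) (χ (c q)))) ⟩
      sumℤ (λ i → χ (c p) ℤ.* χ (c q) ℤ.* (χ (A i p) ℤ.* χ (A i q)))
        ≡⟨ sumℤ-scale (χ (c p) ℤ.* χ (c q)) (λ i → χ (A i p) ℤ.* χ (A i q)) ⟩
      χ (c p) ℤ.* χ (c q) ℤ.* sumℤ (λ i → χ (A i p) ℤ.* χ (A i q))
        ≡⟨ cong (χ (c p) ℤ.* χ (c q) ℤ.*_) (pair u p≢q) ⟩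
      χ (c p) ℤ.* χ (c q) ℤ.* 0ℤ
        ≡⟨ ℤ.*-zeroʳ (χ (c p) ℤ.* χ (c q)) ⟩
      0ℤ ∎
  }
  where
  open ≡-Reasoning
  regroup : ∀ a b c d → (a ℤ.* b) ℤ.* (c ℤ.* d) ≡ b ℤ.* d ℤ.* (a ℤ.* c)
  regroup = solve-∀

unit : Fin k → Vector (Fin 2) k
unit p q = if does (p Fin.≟ q) then suc zero else zero

unit-here : (p : Fin k) → unit p p ≡ suc zero
unit-here p with p Fin.≟ p
... | yes _   = refl
... | no  p≢p = contradiction refl p≢p

unit-there : {p q : Fin k} → p ≢ q → unit p q ≡ zero
unit-there {p = p} {q} p≢q with p Fin.≟ q
... | yes p≡q = contradiction p≡q p≢q
... | no  _   = refl

flip : Fin k → Vector (Fin 2) k → Vector (Fin 2) k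
flip p u q = u q ⊕ unit p q

⊕-zeroʳ : ∀ x → x ⊕ zero ≡ x
⊕-zeroʳ zero       = refl
⊕-zeroʳ (suc zero) = refl

flip-there : {p q : Fin k} → p ≢ q → ∀ u → flip p u q ≡ u q
flip-there {q = q} p≢q u = trans (cong (u q ⊕_) (unit-there p≢q)) (⊕-zeroʳ (u q))

flip-here : (p : Fin k) → ∀ u → flip p u p ≡ u p ⊕ suc zero
flip-here p u = cong (u p ⊕_) (unit-here p)

χ-flip-here : (p : Fin k) → ∀ u → χ (flip p u p) ≡ ℤ.- χ (u p)
χ-flip-here p u = trans (cong χ (flip-here p u)) (lemma (u p))
  where
  lemma : ∀ x → χ (x ⊕ suc zero) ≡ ℤ.- χ x
  lemma zero       = refl
  lemma (suc zero) = refl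

∷-injective : {ι : Fin k → Fin k′} {p : Fin k′} → Injective _≡_ _≡_ ι → (∀ q → p ≢ ι q) →
              Injective _≡_ _≡_ (p ∷ ι)
∷-injective inj p≢ι {zero}  {zero}  eq = refl
∷-injective inj p≢ι {zero}  {suc b} eq = contradiction eq (p≢ι b)
∷-injective inj p≢ι {suc a} {zero}  eq = contradiction (sym eq) (p≢ι a)
∷-injective inj p≢ι {suc a} {suc b} eq = cong suc (inj eq)

doubled : Fin k → Matrix (Vector (Fin 2) k) m n → Matrix (Vector (Fin 2) k) m (n ℕ.+ n)
doubled p D i = D i ++ (flip p ∘ D i)

-- New columns are translates of old ones, so they keep strength 2 in all factors, including those
-- still to be promoted by a later doubling.
doubled-columns : (p : Fin k) (D : Matrix (Vector (Fin 2) k) m n) →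
  (∀ j → Uncorrelated (λ i → D i j)) → ∀ j → Uncorrelated (λ i → doubled p D i j)
doubled-columns {n = n} p D u j with splitAt n j
... | inj₁ j′ = u j′
... | inj₂ j′ = uncorrelated-⊕ (u j′) _

-- Juxtaposing D with its copy in which factor p is complemented promotes p, so far
-- present in the columns only, to a factor of the design.
doubled-isFactorialDesign :
  (D : Matrix (Vector (Fin 2) k′) m n) (ι : Fin k → Fin k′) (p : Fin k′) →
  Injective _≡_ _≡_ ι → (∀ q → p ≢ ι q) → (∀ j → Uncorrelated (λ i → D i j)) →
  IsFactorialDesign k m n 2 2 (λ i j → D i j ∘ ι) →
  1 ≤ k → IsFactorialDesign (suc k) m (n ℕ.+ n) 2 2 (λ i j → doubled p D i j ∘ (p ∷ ι))
doubled-isFactorialDesign {k′} {m} {n} {k} D ι p inj p≢ι u d 1≤k = record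
  { uniform = λ v → begin
      sum (λ i → sum (λ j → indicator (does ((doubled p D i j ∘ (p ∷ ι)) ≗? v)))) * 2 ^ suc k
        ≡⟨ cong (_* 2 ^ suc k) (ℕΣ.sum-cong-≗ (rowFrequency v)) ⟩
      sum (λ i → count (λ j → (D i j ∘ ι) ≗? tail v)) * (2 * 2 ^ k)
        ≡⟨ assoc (sum (λ i → count (λ j → (D i j ∘ ι) ≗? tail v))) (2 ^ k) ⟩
      2 * (sum (λ i → count (λ j → (D i j ∘ ι) ≗? tail v)) * 2 ^ k)
        ≡⟨ cong (2 *_) (IsFactorialDesign.uniform d (tail v)) ⟩
      2 * (m * n)
        ≡⟨ double m n ⟩
      m * (n ℕ.+ n) ∎
  ; rows    = λ i → uncorrelated⇒isOA (s≤s 1≤k) (row i)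
  ; columns = λ j → uncorrelated⇒isOA (s≤s 1≤k)
      (uncorrelated-selectColumns (∷-injective inj p≢ι) (doubled-columns p D u j))
  }
  where
  open ≡-Reasoning
  assoc : ∀ a b → a * (2 * b) ≡ 2 * (a * b)
  assoc = ℕSolver.solve-∀
  double : ∀ a b → 2 * (a * b) ≡ a * (b ℕ.+ b)
  double = ℕSolver.solve-∀

  once : ∀ (x y : Fin 2) b →
    indicator (does (x Fin.≟ y) ∧ b) ℕ.+ indicator (does ((x ⊕ suc zero) Fin.≟ y) ∧ b) ≡ indicator b
  once zero       zero       b = ℕ.+-identityʳ _
  once zero       (suc zero) b = refl
  once (suc zero) zero       b = refl
  once (suc zero) (suc zero) b = ℕ.+-identityʳ _

  -- Exactly one of a cell and its flipped copy agrees with `v` at factor `p`; the other factors do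
  -- not notice the flip.
  cellFrequency : ∀ v (u : Vector (Fin 2) k′) →
    indicator (does ((u ∘ (p ∷ ι)) ≗? v)) ℕ.+ indicator (does ((flip p u ∘ (p ∷ ι)) ≗? v)) ≡
    indicator (does ((u ∘ ι) ≗? tail v))
  cellFrequency v u = trans
    (cong (indicator (does ((u ∘ (p ∷ ι)) ≗? v)) ℕ.+_) (cong indicator
      (cong₂ _∧_ (cong (λ x → does (x Fin.≟ v zero)) (flip-here p u))
        (does-≗?-cong k (λ q → flip-there (p≢ι q) u)))))
    (once (u p) (v zero) (does ((u ∘ ι) ≗? tail v)))

  rowFrequency : ∀ v i → sum (λ j → indicator (does ((doubled p D i j ∘ (p ∷ ι)) ≗? v))) ≡
                         count (λ j → (D i j ∘ ι) ≗? tail v)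
  rowFrequency v i = begin
    sum (λ j → indicator (does ((doubled p D i j ∘ (p ∷ ι)) ≗? v)))
      ≡⟨ sum-++ (λ u → indicator (does ((u ∘ (p ∷ ι)) ≗? v))) (D i) (flip p ∘ D i) ⟩
    sum (λ j → indicator (does ((D i j ∘ (p ∷ ι)) ≗? v))) ℕ.+ sum (λ j → indicator (does ((flip p (D i j) ∘ (p ∷ ι)) ≗? v)))
      ≡⟨ ℕΣ.∑-distrib-+ (λ j → indicator (does ((D i j ∘ (p ∷ ι)) ≗? v))) _ ⟨
    sum (λ j → indicator (does ((D i j ∘ (p ∷ ι)) ≗? v)) ℕ.+ indicator (does ((flip p (D i j) ∘ (p ∷ ι)) ≗? v)))
      ≡⟨ ℕΣ.sum-cong-≗ (λ j → cellFrequency v (D i j)) ⟩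
    count (λ j → (D i j ∘ ι) ≗? tail v) ∎

  halves : ∀ i (f : Vector (Fin 2) k′ → ℤ) → sumℤ (λ j → f (D i j) ℤ.+ f (flip p (D i j))) ≡ 0ℤ →
           sumℤ (λ j → f (doubled p D i j)) ≡ 0ℤ
  halves i f eq = trans (sumℤ-++ f (D i) (flip p ∘ D i)) (trans (sym (sumℤ-+ (f ∘ D i) _)) eq)

  -- For characters involving `p`: the two halves of the row cancel.
  opposite : ∀ i (f : Vector (Fin 2) k′ → ℤ) → (∀ u → f (flip p u) ≡ ℤ.- f u) →
             sumℤ (λ j → f (doubled p D i j)) ≡ 0ℤ
  opposite i f odd = halves i f (trans
    (ℤΣ.sum-cong-≗ (λ j → trans (cong (ℤ._+_ (f (D i j))) (odd (D i j))) (ℤ.+-inverseʳ (f (D i j)))))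
    (ℤΣ.sum-replicate-zero n))

  -- For characters avoiding `p`: both halves give the same sum, which vanishes by the old design.
  equal : ∀ i (f : Vector (Fin 2) k′ → ℤ) → (∀ u → f (flip p u) ≡ f u) → sumℤ (λ j → f (D i j)) ≡ 0ℤ →
          sumℤ (λ j → f (doubled p D i j)) ≡ 0ℤ
  equal i f even Σf≡0 = trans (sumℤ-++ f (D i) (flip p ∘ D i))
    (cong₂ ℤ._+_ Σf≡0 (trans (ℤΣ.sum-cong-≗ (λ j → even (D i j))) Σf≡0))

  row : ∀ i → Uncorrelated (λ j → doubled p D i j ∘ (p ∷ ι))
  row i .single zero    = opposite i (λ u → χ (u p)) (χ-flip-here p)
  row i .single (suc a) = equal i (λ u → χ (u (ι a))) (λ u → cong χ (flip-there (p≢ι a) u))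
    (single (isOA⇒uncorrelated (IsFactorialDesign.rows d i)) a)
  row i .pair {zero}  {zero}  0≢0 = contradiction refl 0≢0
  row i .pair {zero}  {suc b} _   = opposite i (λ u → χ (u p) ℤ.* χ (u (ι b)))
    (λ u → trans (cong₂ ℤ._*_ (χ-flip-here p u) (cong χ (flip-there (p≢ι b) u))) (sym (ℤ.neg-distribˡ-* (χ (u p)) _)))
  row i .pair {suc a} {zero}  _   = opposite i (λ u → χ (u (ι a)) ℤ.* χ (u p))
    (λ u → trans (cong₂ ℤ._*_ (cong χ (flip-there (p≢ι a) u)) (χ-flip-here p u)) (sym (ℤ.neg-distribʳ-* (χ (u (ι a))) _)))
  row i .pair {suc a} {suc b} a≢b = equal i (λ u → χ (u (ι a)) ℤ.* χ (u (ι b)))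
    (λ u → cong₂ (λ x y → χ x ℤ.* χ y) (flip-there (p≢ι a) u) (flip-there (p≢ι b) u))
    (pair (isOA⇒uncorrelated (IsFactorialDesign.rows d i)) (a≢b ∘ cong suc))

-- Translates of the kernel of two functionals

infixl 7 _⊗_
_⊗_ : Fin 2 → Fin 2 → Fin 2
zero     ⊗ y = zero
suc zero ⊗ y = y

⊕-comm : ∀ x y → x ⊕ y ≡ y ⊕ x
⊕-comm = from-yes (Fin.all? λ x → Fin.all? λ y → (x ⊕ y) Fin.≟ (y ⊕ x))

⊕-interchange : ∀ a b c d → (a ⊕ b) ⊕ (c ⊕ d) ≡ (a ⊕ c) ⊕ (b ⊕ d)
⊕-interchange = from-yes (Fin.all? λ a → Fin.all? λ b → Fin.all? λ c → Fin.all? λ d →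
  ((a ⊕ b) ⊕ (c ⊕ d)) Fin.≟ ((a ⊕ c) ⊕ (b ⊕ d)))

⊗-distribˡ-⊕ : ∀ x y z → x ⊗ (y ⊕ z) ≡ x ⊗ y ⊕ x ⊗ z
⊗-distribˡ-⊕ zero       y z = refl
⊗-distribˡ-⊕ (suc zero) y z = refl

⊗-distribʳ-⊕ : ∀ z x y → (x ⊕ y) ⊗ z ≡ x ⊗ z ⊕ y ⊗ z
⊗-distribʳ-⊕ = from-yes (Fin.all? λ z → Fin.all? λ x → Fin.all? λ y → ((x ⊕ y) ⊗ z) Fin.≟ (x ⊗ z ⊕ y ⊗ z))

dot : Vector (Fin 2) r → Vector (Fin 2) r → Fin 2
dot {zero}  φ s = zero
dot {suc r} φ s = head φ ⊗ head s ⊕ dot (tail φ) (tail s)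

dot-cong : (φ : Vector (Fin 2) r) {s t : Vector (Fin 2) r} → s ≗ t → dot φ s ≡ dot φ t
dot-cong {zero}  φ s≗t = refl
dot-cong {suc r} φ s≗t = cong₂ (λ x y → head φ ⊗ x ⊕ y) (s≗t zero) (dot-cong (tail φ) (s≗t ∘ suc))

dot-⊕ʳ : (φ s t : Vector (Fin 2) r) → dot φ (λ p → s p ⊕ t p) ≡ dot φ s ⊕ dot φ t
dot-⊕ʳ {zero}  φ s t = refl
dot-⊕ʳ {suc r} φ s t = trans
  (cong₂ _⊕_ (⊗-distribˡ-⊕ (head φ) (head s) (head t)) (dot-⊕ʳ (tail φ) (tail s) (tail t)))
  (⊕-interchange (head φ ⊗ head s) (head φ ⊗ head t) _ _)

dot-⊕ˡ : (φ ψ s : Vector (Fin 2) r) → dot (λ p → φ p ⊕ ψ p) s ≡ dot φ s ⊕ dot ψ s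
dot-⊕ˡ {zero}  φ ψ s = refl
dot-⊕ˡ {suc r} φ ψ s = trans
  (cong₂ _⊕_ (⊗-distribʳ-⊕ (head s) (head φ) (head ψ)) (dot-⊕ˡ (tail φ) (tail ψ) (tail s)))
  (⊕-interchange (head φ ⊗ head s) (head ψ ⊗ head s) _ _)

dot-zero : (s : Vector (Fin 2) r) → dot (λ _ → zero) s ≡ zero
dot-zero {zero}  s = refl
dot-zero {suc r} s = dot-zero (tail s)

dot-unit : (p : Fin r) (s : Vector (Fin 2) r) → dot (unit p) s ≡ s p
dot-unit zero    s = trans (cong (head s ⊕_) (dot-zero (tail s))) (⊕-zeroʳ (head s))
dot-unit (suc p) s = dot-unit p (tail s)

-- The final `++ []` matches the unfolding of 2 ^ `suc r` to 2 ^ r + (2 ^ r + 0).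
cube : ∀ r → Vector (Vector (Fin 2) r) (2 ^ r)
cube zero    = [] ∷ []
cube (suc r) = ((zero ∷_) ∘ cube r) ++ (((suc zero ∷_) ∘ cube r) ++ [])

sum-cube : (f : Vector (Fin 2) (suc r) → ℕ) →
  sum (f ∘ cube (suc r)) ≡ sum (λ j → f (zero ∷ cube r j)) ℕ.+ sum (λ j → f (suc zero ∷ cube r j))
sum-cube {r} f = trans (sum-++ f ((zero ∷_) ∘ cube r) _) (cong (sum (λ j → f (zero ∷ cube r j)) ℕ.+_)
  (trans (sum-++ f ((suc zero ∷_) ∘ cube r) []) (ℕ.+-identityʳ _)))

sumℤ-cube : (f : Vector (Fin 2) (suc r) → ℤ) →
  sumℤ (f ∘ cube (suc r)) ≡ sumℤ (λ j → f (zero ∷ cube r j)) ℤ.+ sumℤ (λ j → f (suc zero ∷ cube r j))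
sumℤ-cube {r} f = trans (sumℤ-++ f ((zero ∷_) ∘ cube r) _) (cong (ℤ._+_ (sumℤ (λ j → f (zero ∷ cube r j))))
  (trans (sumℤ-++ f ((suc zero ∷_) ∘ cube r) []) (ℤ.+-identityʳ _)))

-- Orthogonality of characters. The halves by first coordinate cancel if `φ` involves it; otherwise
-- the given 1 lies in the tail and each half vanishes by induction.
sum-χ-dot : (φ : Vector (Fin 2) r) {t : Fin r} → φ t ≡ suc zero → sumℤ (λ j → χ (dot φ (cube r j))) ≡ 0ℤ
sum-χ-dot {suc r} φ {t} φt≡1 = trans (sumℤ-cube (χ ∘ dot φ)) (halves t (head φ) refl φt≡1)
  where
  S = sumℤ (λ j → χ (dot (tail φ) (cube r j)))
  halves : ∀ t x → head φ ≡ x → φ t ≡ suc zero →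
    sumℤ (λ j → χ (head φ ⊗ zero ⊕ dot (tail φ) (cube r j))) ℤ.+
    sumℤ (λ j → χ (head φ ⊗ suc zero ⊕ dot (tail φ) (cube r j))) ≡ 0ℤ
  halves t       (suc zero) φ₀≡1 _ rewrite φ₀≡1 = trans
    (cong (ℤ._+_ S) (trans (ℤΣ.sum-cong-≗ (λ j → χ-⊕ (suc zero) (dot (tail φ) (cube r j)))) (sumℤ-scale -1ℤ (λ j → χ (dot (tail φ) (cube r j))))))
    (trans (cong (ℤ._+_ S) (ℤ.-1*i≡-i S)) (ℤ.+-inverseʳ S))
  halves zero    zero       φ₀≡0 φ₀≡1 = contradiction (trans (sym φ₀≡0) φ₀≡1) λ ()
  halves (suc t) zero       φ₀≡0 φt≡1 rewrite φ₀≡0 = cong₂ ℤ._+_ (sum-χ-dot (tail φ) φt≡1) (sum-χ-dot (tail φ) φt≡1)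

-- x ⊕ s = y has the single solution s = x ⊕ y, so one term decides. The enumerated vector equals it
-- only pointwise, hence the congruence assumption on `g`.
sift : (g : Vector (Fin 2) r → Bool) → (∀ {s t} → s ≗ t → g s ≡ g t) → (x y : Vector (Fin 2) r) →
  sum (λ j → indicator (g (cube r j) ∧ does ((λ p → x p ⊕ cube r j p) ≗? y))) ≡
  indicator (g (λ p → x p ⊕ y p))
sift {zero}  g g-cong x y = trans (ℕ.+-identityʳ _) (cong indicator (trans (Bool.∧-identityʳ _) (g-cong λ ())))
sift {suc r} g g-cong x y = trans (sum-cube (λ s → indicator (g s ∧ does ((λ p → x p ⊕ s p) ≗? y)))) (halves (head x) (head y) refl refl)
  where
  g∷ : Fin 2 → Vector (Fin 2) r → Bool
  g∷ b s = g (b ∷ s)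
  ∷-cong : ∀ b {s t : Vector (Fin 2) r} → s ≗ t → (b ∷ s) ≗ (b ∷ t)
  ∷-cong b s≗t zero    = refl
  ∷-cong b s≗t (suc p) = s≗t p
  half : Fin 2 → Bool → ℕ
  half b c = sum (λ j → indicator (g∷ b (cube r j) ∧ (c ∧ does ((λ p → tail x p ⊕ cube r j p) ≗? tail y))))
  hit : ∀ b → head x ⊕ head y ≡ b → half b true ≡ indicator (g (λ p → x p ⊕ y p))
  hit b eq = trans (sift (g∷ b) (g-cong ∘ ∷-cong b) (tail x) (tail y))
    (cong indicator (g-cong λ { zero → sym eq ; (suc p) → refl }))
  miss : ∀ b → half b false ≡ 0
  miss b = trans (ℕΣ.sum-cong-≗ (λ j → cong indicator (Bool.∧-zeroʳ (g∷ b (cube r j))))) (ℕΣ.sum-replicate-zero (2 ^ r))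
  halves : ∀ a b → head x ≡ a → head y ≡ b →
    half zero (does ((head x ⊕ zero) Fin.≟ head y)) ℕ.+ half (suc zero) (does ((head x ⊕ suc zero) Fin.≟ head y)) ≡
    indicator (g (λ p → x p ⊕ y p))
  halves zero       zero       ≡a ≡b rewrite ≡a | ≡b = trans (cong₂ ℕ._+_ (hit zero (cong₂ _⊕_ ≡a ≡b)) (miss (suc zero))) (ℕ.+-identityʳ _)
  halves zero       (suc zero) ≡a ≡b rewrite ≡a | ≡b = cong₂ ℕ._+_ (miss zero) (hit (suc zero) (cong₂ _⊕_ ≡a ≡b))
  halves (suc zero) zero       ≡a ≡b rewrite ≡a | ≡b = cong₂ ℕ._+_ (miss zero) (hit (suc zero) (cong₂ _⊕_ ≡a ≡b))
  halves (suc zero) (suc zero) ≡a ≡b rewrite ≡a | ≡b = trans (cong₂ ℕ._+_ (hit zero (cong₂ _⊕_ ≡a ≡b)) (miss (suc zero))) (ℕ.+-identityʳ _)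

-- What remains of condition (1) once a pivot is removed: such a functional is nonzero and differs
-- from every `unit p`.
TwoOnes : Vector (Fin 2) r → Set
TwoOnes φ = ∃[ t ] ∃[ t′ ] t ≢ t′ × φ t ≡ suc zero × φ t′ ≡ suc zero

-- Columns 0 and 1 are the pivots; `V` and `W` describe the other members of the two sets. The two
-- values of row i name the coset of B that contains `A i`.
sums : Matrix (Fin 2) n (2 ℕ.+ r) → (V W : Vector (Fin 2) r) → Matrix (Fin 2) n 2
sums A V W i = A i zero ⊕ dot V (tail (tail (A i))) ∷ A i (suc zero) ⊕ dot W (tail (tail (A i))) ∷ []

-- Parametrises B by its last r coordinates s: membership forces the pivot coordinates to be
-- `dot V s` and `dot W s`.
functional : (V W : Vector (Fin 2) r) → Fin (2 ℕ.+ r) → Vector (Fin 2) r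
functional V W = V ∷ W ∷ unit

translates : Matrix (Fin 2) n (2 ℕ.+ r) → (V W : Vector (Fin 2) r) → Matrix (Vector (Fin 2) (2 ℕ.+ r)) n (2 ^ r)
translates {r = r} A V W i j p = A i p ⊕ dot (functional V W p) (cube r j)

module _
  (A : Matrix (Fin 2) n (2 ℕ.+ r)) (V W : Vector (Fin 2) r)
  (V-twoOnes : TwoOnes V) (W-twoOnes : TwoOnes W) (V≢W : ∃[ t ] V t ≢ W t)
  where

  private
    functional-nonzero : ∀ p → ∃[ t ] functional V W p t ≡ suc zero
    functional-nonzero zero          = let t , _ , _ , Vt≡1 , _ = V-twoOnes in t , Vt≡1
    functional-nonzero (suc zero)    = let t , _ , _ , Wt≡1 , _ = W-twoOnes in t , Wt≡1
    functional-nonzero (suc (suc p)) = p , unit-here p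

    twoOnes⇒≢unit : {φ : Vector (Fin 2) r} → TwoOnes φ → ∀ p → ∃[ t ] φ t ≢ unit p t
    twoOnes⇒≢unit (t , t′ , t≢t′ , φt≡1 , φt′≡1) p with p Fin.≟ t
    ... | no  p≢t  = t , λ eq → contradiction (trans (sym φt≡1) (trans eq (unit-there p≢t))) λ ()
    ... | yes refl = t′ , λ eq → contradiction (trans (sym φt′≡1) (trans eq (unit-there t≢t′))) λ ()

    -- A dual word of weight 2 would be a pair of equal coordinate functionals on B, one of weight 1
    -- a zero functional.
    functional-distinct : ∀ {p q} → p ≢ q → ∃[ t ] functional V W p t ≢ functional V W q t
    functional-distinct {zero}        {zero}        p≢q = contradiction refl p≢q
    functional-distinct {zero}        {suc zero}    p≢q = V≢W
    functional-distinct {zero}        {suc (suc q)} p≢q = twoOnes⇒≢unit V-twoOnes q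
    functional-distinct {suc zero}    {zero}        p≢q = let t , Vt≢Wt = V≢W in t , Vt≢Wt ∘ sym
    functional-distinct {suc zero}    {suc zero}    p≢q = contradiction refl p≢q
    functional-distinct {suc zero}    {suc (suc q)} p≢q = twoOnes⇒≢unit W-twoOnes q
    functional-distinct {suc (suc p)} {zero}        p≢q = let t , ≢t = twoOnes⇒≢unit V-twoOnes p in t , ≢t ∘ sym
    functional-distinct {suc (suc p)} {suc zero}    p≢q = let t , ≢t = twoOnes⇒≢unit W-twoOnes p in t , ≢t ∘ sym
    functional-distinct {suc (suc p)} {suc (suc q)} p≢q = p , λ eq →
      contradiction (trans (sym (unit-here p)) (trans eq (unit-there {p = q} {q = p} (λ q≡p → p≢q (cong (λ i → suc (suc i)) (sym q≡p)))))) λ ()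

    ≢⇒⊕≡1 : ∀ x y → x ≢ y → x ⊕ y ≡ suc zero
    ≢⇒⊕≡1 zero       zero       x≢y = contradiction refl x≢y
    ≢⇒⊕≡1 zero       (suc zero) x≢y = refl
    ≢⇒⊕≡1 (suc zero) zero       x≢y = refl
    ≢⇒⊕≡1 (suc zero) (suc zero) x≢y = contradiction refl x≢y

    -- Strength 2 of B: a product of two characters belongs to the sum of two distinct functionals,
    -- which is nonzero.
    values-uncorrelated : Uncorrelated (λ j p → dot (functional V W p) (cube r j))
    values-uncorrelated .single p = sum-χ-dot (functional V W p) (proj₂ (functional-nonzero p))
    values-uncorrelated .pair {p} {q} p≢q = let t , ≢t = functional-distinct p≢q in trans
      (ℤΣ.sum-cong-≗ (λ j → trans (sym (χ-⊕ (dot (functional V W p) (cube r j)) (dot (functional V W q) (cube r j))))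
        (cong χ (sym (dot-⊕ˡ (functional V W p) (functional V W q) (cube r j))))))
      (sum-χ-dot (λ s → functional V W p s ⊕ functional V W q s) (≢⇒⊕≡1 (functional V W p t) (functional V W q t) ≢t))

    move : ∀ a c d v → does ((a ⊕ (c ⊕ d)) Fin.≟ v) ≡ does ((a ⊕ c) Fin.≟ (v ⊕ d))
    move = from-yes (Fin.all? λ a → Fin.all? λ c → Fin.all? λ d → Fin.all? λ v →
      does ((a ⊕ (c ⊕ d)) Fin.≟ v) Bool.≟ does ((a ⊕ c) Fin.≟ (v ⊕ d)))

    module _ (v : Vector (Fin 2) (2 ℕ.+ r)) (i : Fin n) where
      x y : Vector (Fin 2) r
      x = tail (tail (A i))
      y = tail (tail v)

      pivotsMatch : Vector (Fin 2) r → Bool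
      pivotsMatch s = does ((A i zero ⊕ dot V s) Fin.≟ v zero) ∧ does ((A i (suc zero) ⊕ dot W s) Fin.≟ v (suc zero))

      pivotsMatch-cong : ∀ {s t} → s ≗ t → pivotsMatch s ≡ pivotsMatch t
      pivotsMatch-cong s≗t = cong₂ (λ f g → does ((A i zero ⊕ f) Fin.≟ v zero) ∧ does ((A i (suc zero) ⊕ g) Fin.≟ v (suc zero)))
        (dot-cong V s≗t) (dot-cong W s≗t)

      -- The last r coordinates of `v` leave s = x ⊕ y as the only candidate; the pivots then match
      -- exactly when `A i` and `v` have the same two sums.
      rowFrequency : count (λ j → translates A V W i j ≗? v) ≡
        indicator (does (sums A V W i zero Fin.≟ (v zero ⊕ dot V y)) ∧ (does (sums A V W i (suc zero) Fin.≟ (v (suc zero) ⊕ dot W y)) ∧ true))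
      rowFrequency = begin
        count (λ j → translates A V W i j ≗? v)
          ≡⟨ ℕΣ.sum-cong-≗ (λ j → cong indicator (trans (sym (Bool.∧-assoc (does (translates A V W i j zero Fin.≟ v zero)) _ _))
               (cong (pivotsMatch (cube r j) ∧_) (does-≗?-cong r (λ p → cong (x p ⊕_) (dot-unit p (cube r j))))))) ⟩
        sum (λ j → indicator (pivotsMatch (cube r j) ∧ does ((λ p → x p ⊕ cube r j p) ≗? y)))
          ≡⟨ sift pivotsMatch pivotsMatch-cong x y ⟩
        indicator (pivotsMatch (λ p → x p ⊕ y p))
          ≡⟨ cong indicator (cong₂ _∧_
               (trans (cong (λ f → does ((A i zero ⊕ f) Fin.≟ v zero)) (dot-⊕ʳ V x y)) (move (A i zero) (dot V x) (dot V y) (v zero)))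
               (trans (trans (cong (λ f → does ((A i (suc zero) ⊕ f) Fin.≟ v (suc zero))) (dot-⊕ʳ W x y))
                 (move (A i (suc zero)) (dot W x) (dot W y) (v (suc zero)))) (sym (Bool.∧-identityʳ _)))) ⟩
        indicator (does (sums A V W i zero Fin.≟ (v zero ⊕ dot V y)) ∧ (does (sums A V W i (suc zero) Fin.≟ (v (suc zero) ⊕ dot W y)) ∧ true)) ∎
        where open ≡-Reasoning

  -- Row i is a coset of the kernel B of the pair of functionals {0} ∪ V and {1} ∪ W, so uniformity only
  -- asks that the rows of A meet the four cosets of B equally often.
  translates-isFactorialDesign : Uncorrelated A → Uncorrelated (sums A V W) → IsFactorialDesign (2 ℕ.+ r) n (2 ^ r) 2 2 (translates A V W)
  translates-isFactorialDesign uA uS = record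
    { uniform = λ v → begin
        sum (λ i → count (λ j → translates A V W i j ≗? v)) * 2 ^ (2 ℕ.+ r)
          ≡⟨ cong (_* 2 ^ (2 ℕ.+ r)) (ℕΣ.sum-cong-≗ (rowFrequency v)) ⟩
        S v * 2 ^ (2 ℕ.+ r)
          ≡⟨ regroup (S v) (2 ^ r) ⟩
        S v * 4 * 2 ^ r
          ≡⟨ cong (_* 2 ^ r) (uncorrelated⇒count (λ i → sums A V W i zero) (λ i → sums A V W i (suc zero))
               (single uS zero) (single uS (suc zero)) (pair uS {zero} {suc zero} λ ()) _ _) ⟩
        n * 2 ^ r ∎
    ; rows    = λ i → uncorrelated⇒isOA (s≤s (s≤s z≤n)) (uncorrelated-cong (λ j p → ⊕-comm _ (A i p))
        (uncorrelated-⊕ values-uncorrelated (A i)))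
    ; columns = λ j → uncorrelated⇒isOA (s≤s (s≤s z≤n)) (uncorrelated-⊕ uA _)
    }
    where
    open ≡-Reasoning
    S : Vector (Fin 2) (2 ℕ.+ r) → ℕ
    S v = sum (λ i → indicator (does (sums A V W i zero Fin.≟ (v zero ⊕ dot V (tail (tail v)))) ∧
      (does (sums A V W i (suc zero) Fin.≟ (v (suc zero) ⊕ dot W (tail (tail v)))) ∧ true)))
    regroup : ∀ s c → s * (2 * (2 * c)) ≡ s * 4 * c
    regroup = ℕSolver.solve-∀

-- Designs with few rows

uncorrelated? : (A : Matrix (Fin 2) n k) → Dec (Uncorrelated A)
uncorrelated? A = map′
  (λ (s , t) → record { single = s ; pair = λ {p} {q} → t p q })
  (λ u → single u , λ p q → pair u)
  ((Fin.all? λ p → sumℤ (λ i → χ (A i p)) ℤ.≟ 0ℤ) ×-dec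
   (Fin.all? λ p → Fin.all? λ q → ¬? (p Fin.≟ q) →-dec (sumℤ (λ i → χ (A i p) ℤ.* χ (A i q)) ℤ.≟ 0ℤ)))

-- Vectors are replaced by their codes in `Fin (2 ^ k)`, so that everything is a finite check.
Verified : Matrix (Vector (Fin 2) k) m n → Set
Verified {k} {m} {n} D =
  (∀ c → sum (λ i → count (λ j → D i j ≗? finToFun {2} {k} c)) * 2 ^ k ≡ m * n) ×
  (∀ i → Uncorrelated (λ j → D i j)) ×
  (∀ j → Uncorrelated (λ i → D i j))

verified? : (D : Matrix (Vector (Fin 2) k) m n) → Dec (Verified D)
verified? {k} {m} {n} D =
  (Fin.all? λ c → sum (λ i → count (λ j → D i j ≗? finToFun {2} {k} c)) * 2 ^ k ℕ.≟ m * n) ×-dec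
  (Fin.all? λ i → uncorrelated? (λ j → D i j)) ×-dec
  (Fin.all? λ j → uncorrelated? (λ i → D i j))

does-≗?-congʳ : ∀ {q} k {u v v′ : Vector (Fin q) k} → v ≗ v′ → does (u ≗? v) ≡ does (u ≗? v′)
does-≗?-congʳ zero    v≗v′ = refl
does-≗?-congʳ (suc k) {u} v≗v′ =
  cong₂ _∧_ (cong (λ x → does (u zero Fin.≟ x)) (v≗v′ zero)) (does-≗?-congʳ k (v≗v′ ∘ suc))

verified⇒isFactorialDesign : {D : Matrix (Vector (Fin 2) k) m n} → 2 ≤ k → Verified D → IsFactorialDesign k m n 2 2 D
verified⇒isFactorialDesign {k} {D = D} 2≤k (uniform , rows , columns) = record
  { uniform = λ v → trans
      (cong (_* 2 ^ k) (ℕΣ.sum-cong-≗ λ i → ℕΣ.sum-cong-≗ λ j → cong indicator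
        (does-≗?-congʳ k {u = D i j} (λ p → sym (Fin.finToFun-funToFin v p)))))
      (uniform (funToFin v))
  ; rows    = uncorrelated⇒isOA 2≤k ∘ rows
  ; columns = uncorrelated⇒isOA 2≤k ∘ columns
  }

-- Lowest bit first.
binary : ∀ k → ℕ → Vector (Fin 2) k
binary zero    c = []
binary (suc k) c = c mod 2 ∷ binary k (c / 2)

fromTable : ∀ k → Vec (Vec ℕ n) m → Matrix (Vector (Fin 2) k) m n
fromTable k T i j = binary k (lookup (lookup T i) j)

-- The addition table of 𝔽₂².
design-2-4-4 : FactorialDesign 2 4 4 2 2
design-2-4-4 = D , verified⇒isFactorialDesign (s≤s (s≤s z≤n)) (from-yes (verified? D))
  where
  D = fromTable 2
    ( (0 ◂ 1 ◂ 2 ◂ 3 ◂ ⟨⟩)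
    ◂ (1 ◂ 0 ◂ 3 ◂ 2 ◂ ⟨⟩)
    ◂ (2 ◂ 3 ◂ 0 ◂ 1 ◂ ⟨⟩)
    ◂ (3 ◂ 2 ◂ 1 ◂ 0 ◂ ⟨⟩)
    ◂ ⟨⟩ )

-- Entry (i, j) is a ⊕ j, with a running through the even weight vectors 0, 3, 5, 6. Columns have
-- constant parity, as they must; with 8 of them both parities get equally many.
design-3-4-8 : FactorialDesign 3 4 8 2 2
design-3-4-8 = D , verified⇒isFactorialDesign (s≤s (s≤s z≤n)) (from-yes (verified? D))
  where
  D = fromTable 3
    ( (0 ◂ 1 ◂ 2 ◂ 3 ◂ 4 ◂ 5 ◂ 6 ◂ 7 ◂ ⟨⟩)
    ◂ (3 ◂ 2 ◂ 1 ◂ 0 ◂ 7 ◂ 6 ◂ 5 ◂ 4 ◂ ⟨⟩)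
    ◂ (5 ◂ 4 ◂ 7 ◂ 6 ◂ 1 ◂ 0 ◂ 3 ◂ 2 ◂ ⟨⟩)
    ◂ (6 ◂ 7 ◂ 4 ◂ 5 ◂ 2 ◂ 3 ◂ 0 ◂ 1 ◂ ⟨⟩)
    ◂ ⟨⟩ )

-- This and the 12 × 8 table below were found by computer search.
design-4-12-12 : FactorialDesign 4 12 12 2 2
design-4-12-12 = D , verified⇒isFactorialDesign (s≤s (s≤s z≤n)) (from-yes (verified? D))
  where
  D = fromTable 4
    ( (7 ◂ 13 ◂ 11 ◂ 4 ◂ 14 ◂ 1 ◂ 3 ◂ 6 ◂ 0 ◂ 13 ◂ 8 ◂ 10 ◂ ⟨⟩)
    ◂ (12 ◂ 3 ◂ 0 ◂ 8 ◂ 2 ◂ 15 ◂ 11 ◂ 6 ◂ 14 ◂ 5 ◂ 5 ◂ 9 ◂ ⟨⟩)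
    ◂ (2 ◂ 4 ◂ 5 ◂ 3 ◂ 8 ◂ 6 ◂ 15 ◂ 8 ◂ 13 ◂ 14 ◂ 11 ◂ 1 ◂ ⟨⟩)
    ◂ (1 ◂ 15 ◂ 3 ◂ 9 ◂ 14 ◂ 4 ◂ 8 ◂ 10 ◂ 7 ◂ 4 ◂ 2 ◂ 13 ◂ ⟨⟩)
    ◂ (11 ◂ 6 ◂ 5 ◂ 1 ◂ 0 ◂ 7 ◂ 12 ◂ 15 ◂ 12 ◂ 2 ◂ 9 ◂ 10 ◂ ⟨⟩)
    ◂ (0 ◂ 14 ◂ 12 ◂ 6 ◂ 11 ◂ 8 ◂ 13 ◂ 5 ◂ 2 ◂ 11 ◂ 1 ◂ 7 ◂ ⟨⟩)
    ◂ (4 ◂ 3 ◂ 8 ◂ 2 ◂ 4 ◂ 10 ◂ 1 ◂ 13 ◂ 9 ◂ 14 ◂ 7 ◂ 15 ◂ ⟨⟩)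
    ◂ (7 ◂ 5 ◂ 9 ◂ 12 ◂ 3 ◂ 13 ◂ 6 ◂ 11 ◂ 10 ◂ 0 ◂ 14 ◂ 0 ◂ ⟨⟩)
    ◂ (10 ◂ 0 ◂ 15 ◂ 5 ◂ 7 ◂ 12 ◂ 6 ◂ 1 ◂ 11 ◂ 9 ◂ 2 ◂ 12 ◂ ⟨⟩)
    ◂ (14 ◂ 8 ◂ 2 ◂ 15 ◂ 13 ◂ 11 ◂ 5 ◂ 3 ◂ 1 ◂ 8 ◂ 4 ◂ 6 ◂ ⟨⟩)
    ◂ (9 ◂ 9 ◂ 14 ◂ 10 ◂ 5 ◂ 2 ◂ 0 ◂ 12 ◂ 4 ◂ 7 ◂ 15 ◂ 3 ◂ ⟨⟩)
    ◂ (13 ◂ 10 ◂ 6 ◂ 15 ◂ 9 ◂ 1 ◂ 10 ◂ 0 ◂ 7 ◂ 3 ◂ 12 ◂ 4 ◂ ⟨⟩)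
    ◂ ⟨⟩ )

-- With 12 rows and 8 columns 2 ^ k ∣ 12 * 8 stops at k = 5. Each further factor costs a doubling of
-- the columns, and the degree 7 of the columns provides for two of them.
module Extend
  (D : Matrix (Vector (Fin 2) 7) m 8)
  (verified : Verified (λ i j → tail (tail (D i j))))
  (columns : ∀ j → Uncorrelated (λ i → D i j))
  where

  private
    ι₅ : Fin 5 → Fin 7
    ι₅ p = suc (suc p)

    ι₅-injective : Injective _≡_ _≡_ ι₅
    ι₅-injective refl = refl

    ι₆ : Fin 6 → Fin 7
    ι₆ = suc zero ∷ ι₅

    design₅ : IsFactorialDesign 5 m 8 2 2 (λ i j → D i j ∘ ι₅)
    design₅ = verified⇒isFactorialDesign (s≤s (s≤s z≤n)) verified

    D₆ : Matrix (Vector (Fin 2) 7) m 16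
    D₆ = doubled (suc zero) D

    design₆ : IsFactorialDesign 6 m 16 2 2 (λ i j → D₆ i j ∘ ι₆)
    design₆ = doubled-isFactorialDesign D ι₅ (suc zero) ι₅-injective (λ _ ()) columns design₅ (s≤s z≤n)

  factors-5 : FactorialDesign 5 m 8 2 2
  factors-5 = _ , design₅

  factors-6 : FactorialDesign 6 m 16 2 2
  factors-6 = _ , design₆

  factors-7 : FactorialDesign 7 m 32 2 2
  factors-7 = _ , doubled-isFactorialDesign D₆ ι₆ zero (∷-injective ι₅-injective (λ _ ())) (λ { zero () ; (suc _) () })
    (doubled-columns (suc zero) D columns) design₆ (s≤s z≤n)

-- In the next two tables the two lowest bits of an entry extend its column to a strength 2 array of
-- degree 7; the design consists of the five higher bits.  table-8 is a sum A i ⊕ B j of two linear arrays.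
table-8 : Matrix (Vector (Fin 2) 7) 8 8
table-8 = fromTable 7
  ( (0 ◂ 12 ◂ 52 ◂ 56 ◂ 84 ◂ 88 ◂ 96 ◂ 108 ◂ ⟨⟩)
  ◂ (102 ◂ 106 ◂ 82 ◂ 94 ◂ 50 ◂ 62 ◂ 6 ◂ 10 ◂ ⟨⟩)
  ◂ (43 ◂ 39 ◂ 31 ◂ 19 ◂ 127 ◂ 115 ◂ 75 ◂ 71 ◂ ⟨⟩)
  ◂ (77 ◂ 65 ◂ 121 ◂ 117 ◂ 25 ◂ 21 ◂ 45 ◂ 33 ◂ ⟨⟩)
  ◂ (83 ◂ 95 ◂ 103 ◂ 107 ◂ 7 ◂ 11 ◂ 51 ◂ 63 ◂ ⟨⟩)
  ◂ (53 ◂ 57 ◂ 1 ◂ 13 ◂ 97 ◂ 109 ◂ 85 ◂ 89 ◂ ⟨⟩)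
  ◂ (120 ◂ 116 ◂ 76 ◂ 64 ◂ 44 ◂ 32 ◂ 24 ◂ 20 ◂ ⟨⟩)
  ◂ (30 ◂ 18 ◂ 42 ◂ 38 ◂ 74 ◂ 70 ◂ 126 ◂ 114 ◂ ⟨⟩)
  ◂ ⟨⟩ )

table-12 : Matrix (Vector (Fin 2) 7) 12 8
table-12 = fromTable 7
  ( (76 ◂ 52 ◂ 120 ◂ 0 ◂ 28 ◂ 80 ◂ 100 ◂ 40 ◂ ⟨⟩)
  ◂ (104 ◂ 92 ◂ 64 ◂ 56 ◂ 116 ◂ 36 ◂ 16 ◂ 12 ◂ ⟨⟩)
  ◂ (114 ◂ 8 ◂ 34 ◂ 22 ◂ 110 ◂ 70 ◂ 60 ◂ 90 ◂ ⟨⟩)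
  ◂ (25 ◂ 47 ◂ 85 ◂ 97 ◂ 73 ◂ 125 ◂ 7 ◂ 49 ◂ ⟨⟩)
  ◂ (117 ◂ 50 ◂ 30 ◂ 47 ◂ 69 ◂ 104 ◂ 90 ◂ 3 ◂ ⟨⟩)
  ◂ (67 ◂ 5 ◂ 111 ◂ 93 ◂ 115 ◂ 26 ◂ 41 ◂ 54 ◂ ⟨⟩)
  ◂ (16 ◂ 87 ◂ 75 ◂ 122 ◂ 32 ◂ 62 ◂ 14 ◂ 102 ◂ ⟨⟩)
  ◂ (37 ◂ 97 ◂ 57 ◂ 11 ◂ 23 ◂ 79 ◂ 127 ◂ 80 ◂ ⟨⟩)
  ◂ (62 ◂ 27 ◂ 37 ◂ 76 ◂ 2 ◂ 115 ◂ 85 ◂ 107 ◂ ⟨⟩)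
  ◂ (43 ◂ 66 ◂ 12 ◂ 102 ◂ 90 ◂ 21 ◂ 51 ◂ 125 ◂ ⟨⟩)
  ◂ (6 ◂ 110 ◂ 118 ◂ 83 ◂ 57 ◂ 35 ◂ 73 ◂ 31 ◂ ⟨⟩)
  ◂ (95 ◂ 121 ◂ 19 ◂ 53 ◂ 47 ◂ 9 ◂ 98 ◂ 69 ◂ ⟨⟩)
  ◂ ⟨⟩ )

module Eight  = Extend table-8 (from-yes (verified? λ i j → tail (tail (table-8 i j)))) (from-yes (Fin.all? λ j → uncorrelated? (λ i → table-8 i j)))
module Twelve = Extend table-12 (from-yes (verified? λ i j → tail (tail (table-12 i j)))) (from-yes (Fin.all? λ j → uncorrelated? (λ i → table-12 i j)))

-- Hadamard matrices

-- The entry 1 becomes the bit 1, whose character value is -1: all signs are negated, which products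
-- of two columns do not see.
χ-toBit : ∀ {x} → x ≡ 1ℤ ⊎ x ≡ -1ℤ → χ (toBit x) ≡ -1ℤ ℤ.* x
χ-toBit (inj₁ refl) = refl
χ-toBit (inj₂ refl) = refl

module _ {H : Matrix ℤ n n} (hadamard : IsHadamard n H) where

  entry² : ∀ i j → square (H i j) ≡ 1ℤ
  entry² i j with IsHadamard.entries hadamard i j
  ... | inj₁ H≡1  = cong square H≡1
  ... | inj₂ H≡-1 = cong square H≡-1

  -- Parseval for the orthogonal rows, applied to column p: its products with all columns have square
  -- sum n², which its product with itself already attains.
  columns-orthogonal : ∀ {p q} → p ≢ q → sumℤ (λ i → H i p ℤ.* H i q) ≡ 0ℤ
  columns-orthogonal {p} {q} p≢q = sum-squares-concentrated (λ j → sumℤ (λ i → H i p ℤ.* H i j)) p≢q (trans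
    (parseval (λ j i → H i j) (+ n) (IsHadamard.HHᵀ≡nI hadamard) (λ i → H i p) (λ i → entry² i p))
    (cong square (sym (trans (ℤΣ.sum-cong-≗ (λ i → entry² i p)) (trans (sumℤ-const n 1ℤ) (ℤ.*-identityʳ (+ n)))))))

hadamardArray-uncorrelated : {H : Matrix ℤ (suc n) (suc n)} → IsHadamard (suc n) H → IsNormalized H →
                             Uncorrelated (hadamardArray H)
hadamardArray-uncorrelated {n} {H} hadamard normalized = record
  -- The first column is constantly 1, so a column sum is an inner product with it.
  { single = λ p → begin
      sumℤ (λ i → χ (toBit (H i (suc p))))
        ≡⟨ ℤΣ.sum-cong-≗ (λ i → trans (χ-toBit (IsHadamard.entries hadamard i (suc p))) (cong (-1ℤ ℤ.*_)
             (trans (sym (ℤ.*-identityˡ (H i (suc p)))) (cong (ℤ._* H i (suc p)) (sym (IsNormalized.firstColumn normalized i zero refl)))))) ⟩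
      sumℤ (λ i → -1ℤ ℤ.* (H i zero ℤ.* H i (suc p)))
        ≡⟨ sumℤ-scale -1ℤ (λ i → H i zero ℤ.* H i (suc p)) ⟩
      -1ℤ ℤ.* sumℤ (λ i → H i zero ℤ.* H i (suc p))
        ≡⟨ cong (-1ℤ ℤ.*_) (columns-orthogonal hadamard λ ()) ⟩
      0ℤ ∎
  ; pair = λ {p} {q} p≢q → trans
      (ℤΣ.sum-cong-≗ (λ i → trans
        (cong₂ ℤ._*_ (χ-toBit (IsHadamard.entries hadamard i (suc p))) (χ-toBit (IsHadamard.entries hadamard i (suc q))))
        (signs (H i (suc p)) (H i (suc q)))))
      (columns-orthogonal hadamard (p≢q ∘ Fin.suc-injective))
  }
  where
  open ≡-Reasoning
  signs : ∀ x y → -1ℤ ℤ.* x ℤ.* (-1ℤ ℤ.* y) ≡ x ℤ.* y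
  signs = solve-∀

-- Pigeonhole: if `f` hit everything, choosing preimages would inject `Fin K` into `Fin s`.
missing : {f : Fin s → Fin K} → s ℕ.< K → ∃[ y ] (∀ x → y ≢ f x)
missing {s} {K} {f} s<K with Fin.any? (λ y → Fin.all? (λ x → ¬? (y Fin.≟ f x)))
... | yes found = found
... | no  none  = contradiction (Fin.injective⇒≤ {f = proj₁ ∘ preimage} preimage-injective) (ℕ.<⇒≱ s<K)
  where
  preimage : ∀ y → ∃[ x ] y ≡ f x
  preimage y with Fin.any? (λ x → y Fin.≟ f x)
  ... | yes found = found
  ... | no  ∄x    = contradiction (y , λ x y≡fx → ∄x (x , y≡fx)) none
  preimage-injective : Injective _≡_ _≡_ (proj₁ ∘ preimage)
  preimage-injective {y} {y′} eq = trans (proj₂ (preimage y)) (trans (cong f eq) (sym (proj₂ (preimage y′))))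

-- Columns of B together with two sets of selected columns, {0} ∪ V and {1} ∪ W.
record Selection (B : Matrix (Fin 2) n K) (r : ℕ) : Set where
  field
    column           : Fin (2 ℕ.+ r) → Fin K
    column-injective : Injective _≡_ _≡_ column
    V W              : Vector (Fin 2) r
    V-twoOnes        : TwoOnes V
    W-twoOnes        : TwoOnes W
    V≢W              : ∃[ t ] V t ≢ W t
    sums-uncorrelated : Uncorrelated (sums (selectColumns B column) V W)

selection⇒design : {B : Matrix (Fin 2) n K} → Uncorrelated B → Selection B r → FactorialDesign (2 ℕ.+ r) n (2 ^ r) 2 2
selection⇒design uB S = _ ,
  translates-isFactorialDesign _ V W V-twoOnes W-twoOnes V≢W (uncorrelated-selectColumns column-injective uB) sums-uncorrelated
  where open Selection S

private
  -- Brings a column consed at the front to position 2, since positions 0 and 1 are reserved for the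
  -- pivots.
  rotate : Fin (3 ℕ.+ r) → Fin (3 ℕ.+ r)
  rotate zero                = suc zero
  rotate (suc zero)          = suc (suc zero)
  rotate (suc (suc zero))    = zero
  rotate (suc (suc (suc p))) = suc (suc (suc p))

  rotate⁻¹ : Fin (3 ℕ.+ r) → Fin (3 ℕ.+ r)
  rotate⁻¹ zero                = suc (suc zero)
  rotate⁻¹ (suc zero)          = zero
  rotate⁻¹ (suc (suc zero))    = suc zero
  rotate⁻¹ (suc (suc (suc p))) = suc (suc (suc p))

  rotate⁻¹-rotate : (p : Fin (3 ℕ.+ r)) → rotate⁻¹ (rotate p) ≡ p
  rotate⁻¹-rotate zero                = refl
  rotate⁻¹-rotate (suc zero)          = refl
  rotate⁻¹-rotate (suc (suc zero))    = refl
  rotate⁻¹-rotate (suc (suc (suc p))) = refl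

  rotate-injective : {p q : Fin (3 ℕ.+ r)} → rotate p ≡ rotate q → p ≡ q
  rotate-injective {p = p} {q} eq = trans (sym (rotate⁻¹-rotate p)) (trans (cong rotate⁻¹ eq) (rotate⁻¹-rotate q))

-- The new column joins neither set, so both sums stay the same definitionally.
insertColumn : {B : Matrix (Fin 2) n K} → 2 ℕ.+ r ℕ.< K → Selection B r → Selection B (suc r)
insertColumn {r = r} {B} 2+r<K S = record
  { column            = (y ∷ column) ∘ rotate
  ; column-injective  = rotate-injective ∘ ∷-injective column-injective y≢column
  ; V                 = zero ∷ V
  ; W                 = zero ∷ W
  ; V-twoOnes         = lift V-twoOnes
  ; W-twoOnes         = lift W-twoOnes
  ; V≢W               = let t , Vt≢Wt = V≢W in suc t , Vt≢Wt
  ; sums-uncorrelated = sums-uncorrelated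
  }
  where
  open Selection S
  y = proj₁ (missing {f = column} 2+r<K)
  y≢column = proj₂ (missing {f = column} 2+r<K)
  lift : {φ : Vector (Fin 2) r} → TwoOnes φ → TwoOnes (zero ∷ φ)
  lift (t , t′ , t≢t′ , eq , eq′) = suc t , suc t′ , t≢t′ ∘ Fin.suc-injective , eq , eq′

insertColumns : {B : Matrix (Fin 2) n K} → ∀ e → e ℕ.+ (2 ℕ.+ r) ≤ K → Selection B r → Selection B (e ℕ.+ r)
insertColumns                 zero    _   S = S
insertColumns {K = K} {r = r} (suc e) e+2+r<K S =
  insertColumn (subst (ℕ._< K) (shift e r) e+2+r<K) (insertColumns e (ℕ.<⇒≤ e+2+r<K) S)
  where
  shift : ∀ e r → e ℕ.+ (2 ℕ.+ r) ≡ 2 ℕ.+ (e ℕ.+ r)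
  shift = ℕSolver.solve-∀

-- From sets of columns to functionals

bit : Bool → Fin 2
bit b = if b then suc zero else zero

onesOf : (b : Vector Bool r) → 1 ≤ sum (indicator ∘ b) → ∃[ t ] bit (b t) ≡ suc zero
onesOf {suc r} b 1≤ with b zero in eq
... | true  = zero , cong bit eq
... | false = let t , bt = onesOf (tail b) 1≤ in suc t , bt

twoOnesOf : (b : Vector Bool r) → 2 ≤ sum (indicator ∘ b) → TwoOnes (bit ∘ b)
twoOnesOf {suc r} b 2≤ with b zero in eq
... | true  = let t , bt = onesOf (tail b) (ℕ.s≤s⁻¹ 2≤) in zero , suc t , (λ ()) , cong bit eq , bt
... | false = let t , t′ , t≢t′ , bt , bt′ = twoOnesOf (tail b) 2≤ in suc t , suc t′ , t≢t′ ∘ Fin.suc-injective , bt , bt′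

mod2-+ : ∀ a b → (a ℕ.+ b) mod 2 ≡ (a mod 2) ⊕ (b mod 2)
mod2-+ zero          b             = refl
mod2-+ (suc zero)    zero          = refl
mod2-+ (suc zero)    (suc zero)    = refl
mod2-+ (suc zero)    (suc (suc b)) = mod2-+ (suc zero) b
mod2-+ (suc (suc a)) b             = mod2-+ a b

mod2-toℕ : ∀ x → toℕ x mod 2 ≡ x
mod2-toℕ zero       = refl
mod2-toℕ (suc zero) = refl

mod2-dot : (b : Vector Bool r) (x : Vector (Fin 2) r) →
           sum (λ t → if b t then toℕ (x t) else 0) mod 2 ≡ dot (bit ∘ b) x
mod2-dot {zero}  b x = refl
mod2-dot {suc r} b x = trans
  (mod2-+ (if head b then toℕ (head x) else 0) _)
  (cong₂ _⊕_ (term (head b) (head x)) (mod2-dot (tail b) (tail x)))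
  where
  term : ∀ b x → (if b then toℕ x else 0) mod 2 ≡ bit b ⊗ x
  term true  x = mod2-toℕ x
  term false x = refl

card-sum : (p : Subset n) → ∣ p ∣ ≡ sum (λ j → indicator (does (j ∈? p)))
card-sum Vec.[]            = refl
card-sum (true  Vec.∷ p) = cong suc (card-sum p)
card-sum (false Vec.∷ p) = card-sum p

x∉p-x : (p : Subset n) (x : Fin n) → x ∉ₛ p - x
x∉p-x (_ Vec.∷ p) zero    ()
x∉p-x (_ Vec.∷ p) (suc x) (Vec.there x∈) = x∉p-x p x x∈

-- By χ x = 1 - 2x the character sums are 4ℓ - 2(2ℓ) and 4ℓ - 2(2ℓ) - 2(2ℓ) + 4ℓ.
orthogonal⇒uncorrelated : (X Y : Vector (Fin 2) (4 * ℓ)) → Orthogonal ℓ X Y → Uncorrelated (λ i → X i ∷ Y i ∷ [])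
orthogonal⇒uncorrelated {ℓ} X Y o = record
  { single = λ { zero → ΣX X (Orthogonal.weightˡ o) ; (suc zero) → ΣX Y (Orthogonal.weightʳ o) }
  ; pair   = λ { {zero}     {zero}     0≢0 → contradiction refl 0≢0
               ; {zero}     {suc zero} _   → ΣXY
               ; {suc zero} {zero}     _   → trans (ℤΣ.sum-cong-≗ (λ i → ℤ.*-comm (χ (Y i)) (χ (X i)))) ΣXY
               ; {suc zero} {suc zero} 1≢1 → contradiction refl 1≢1 }
  }
  where
  open ≡-Reasoning
  total : sumℤ {4 * ℓ} (λ _ → 1ℤ) ≡ + 4 ℤ.* + ℓ
  total = trans (sumℤ-const (4 * ℓ) 1ℤ) (trans (ℤ.*-identityʳ (+ (4 * ℓ))) (ℤ.pos-* 4 ℓ))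
  one : Vector (Fin 2) (4 * ℓ) → Vector ℕ (4 * ℓ)
  one Z i = indicator (does (Z i Fin.≟ suc zero))
  both : Vector ℕ (4 * ℓ)
  both i = indicator (does (X i Fin.≟ suc zero) ∧ does (Y i Fin.≟ suc zero))
  scaled : ∀ c (f : Vector ℕ (4 * ℓ)) {w} → sum f ≡ w → sumℤ (λ i → c ℤ.* + f i) ≡ c ℤ.* + w
  scaled c f Σf≡w = trans (sumℤ-scale c (+_ ∘ f)) (cong (c ℤ.*_) (trans (sym (pos-sum f)) (cong +_ Σf≡w)))
  χ-one : ∀ x → χ x ≡ 1ℤ ℤ.+ ℤ.-[1+ 1 ] ℤ.* + indicator (does (x Fin.≟ suc zero))
  χ-one zero       = refl
  χ-one (suc zero) = refl
  ΣX : ∀ Z → weight Z ≡ 2 * ℓ → sumℤ (λ i → χ (Z i)) ≡ 0ℤ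
  ΣX Z weight≡2ℓ = begin
    sumℤ (λ i → χ (Z i))                                             ≡⟨ ℤΣ.sum-cong-≗ (λ i → χ-one (Z i)) ⟩
    sumℤ (λ i → 1ℤ ℤ.+ ℤ.-[1+ 1 ] ℤ.* + one Z i)                      ≡⟨ sumℤ-+ {4 * ℓ} (λ _ → 1ℤ) _ ⟩
    sumℤ {4 * ℓ} (λ _ → 1ℤ) ℤ.+ sumℤ (λ i → ℤ.-[1+ 1 ] ℤ.* + one Z i) ≡⟨ cong₂ ℤ._+_ total (scaled ℤ.-[1+ 1 ] (one Z) weight≡2ℓ) ⟩
    + 4 ℤ.* + ℓ ℤ.+ ℤ.-[1+ 1 ] ℤ.* + (2 * ℓ)                          ≡⟨ cong (λ x → + 4 ℤ.* + ℓ ℤ.+ ℤ.-[1+ 1 ] ℤ.* x) (ℤ.pos-* 2 ℓ) ⟩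
    + 4 ℤ.* + ℓ ℤ.+ ℤ.-[1+ 1 ] ℤ.* (+ 2 ℤ.* + ℓ)                      ≡⟨ cancel (+ ℓ) ⟩
    0ℤ                                                               ∎
    where
    cancel : ∀ x → + 4 ℤ.* x ℤ.+ ℤ.-[1+ 1 ] ℤ.* (+ 2 ℤ.* x) ≡ 0ℤ
    cancel = solve-∀
  χχ-one : ∀ x y → let [_] = λ z → + indicator (does (z Fin.≟ suc zero)) in
    χ x ℤ.* χ y ≡ 1ℤ ℤ.+ (ℤ.-[1+ 1 ] ℤ.* [ x ] ℤ.+ (ℤ.-[1+ 1 ] ℤ.* [ y ] ℤ.+
      + 4 ℤ.* + indicator (does (x Fin.≟ suc zero) ∧ does (y Fin.≟ suc zero))))
  χχ-one zero       zero       = refl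
  χχ-one zero       (suc zero) = refl
  χχ-one (suc zero) zero       = refl
  χχ-one (suc zero) (suc zero) = refl
  ΣXY : sumℤ (λ i → χ (X i) ℤ.* χ (Y i)) ≡ 0ℤ
  ΣXY = begin
    sumℤ (λ i → χ (X i) ℤ.* χ (Y i))
      ≡⟨ ℤΣ.sum-cong-≗ (λ i → χχ-one (X i) (Y i)) ⟩
    sumℤ (λ i → 1ℤ ℤ.+ (ℤ.-[1+ 1 ] ℤ.* + one X i ℤ.+ (ℤ.-[1+ 1 ] ℤ.* + one Y i ℤ.+ + 4 ℤ.* + both i)))
      ≡⟨ trans (sumℤ-+ {4 * ℓ} (λ _ → 1ℤ) _) (cong₂ ℤ._+_ total
         (trans (sumℤ-+ (λ i → ℤ.-[1+ 1 ] ℤ.* + one X i) _) (cong₂ ℤ._+_ (scaled ℤ.-[1+ 1 ] (one X) (Orthogonal.weightˡ o))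
         (trans (sumℤ-+ (λ i → ℤ.-[1+ 1 ] ℤ.* + one Y i) _) (cong₂ ℤ._+_ (scaled ℤ.-[1+ 1 ] (one Y) (Orthogonal.weightʳ o))
         (scaled (+ 4) both (Orthogonal.common o))))))) ⟩
    + 4 ℤ.* + ℓ ℤ.+ (ℤ.-[1+ 1 ] ℤ.* + (2 * ℓ) ℤ.+ (ℤ.-[1+ 1 ] ℤ.* + (2 * ℓ) ℤ.+ + 4 ℤ.* + ℓ))
      ≡⟨ cong (λ x → + 4 ℤ.* + ℓ ℤ.+ (ℤ.-[1+ 1 ] ℤ.* x ℤ.+ (ℤ.-[1+ 1 ] ℤ.* x ℤ.+ + 4 ℤ.* + ℓ))) (ℤ.pos-* 2 ℓ) ⟩
    + 4 ℤ.* + ℓ ℤ.+ (ℤ.-[1+ 1 ] ℤ.* (+ 2 ℤ.* + ℓ) ℤ.+ (ℤ.-[1+ 1 ] ℤ.* (+ 2 ℤ.* + ℓ) ℤ.+ + 4 ℤ.* + ℓ))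
      ≡⟨ cancel (+ ℓ) ⟩
    0ℤ ∎
    where
    cancel : ∀ x → + 4 ℤ.* x ℤ.+ (ℤ.-[1+ 1 ] ℤ.* (+ 2 ℤ.* x) ℤ.+ (ℤ.-[1+ 1 ] ℤ.* (+ 2 ℤ.* x) ℤ.+ + 4 ℤ.* x)) ≡ 0ℤ
    cancel = solve-∀

module _ {B : Matrix (Fin 2) (4 * ℓ) K} {c : Fin (2 ℕ.+ r) → Fin K} (c-injective : Injective _≡_ _≡_ c)
  {V W : Subset (2 ℕ.+ r)} (suitable : IsSuitablePair ℓ (selectColumns B c) V W) where

  open IsSuitablePair suitable

  private
    v w : Fin (2 ℕ.+ r)
    v = proj₁ exchange
    w = proj₁ (proj₂ exchange)

    v∈V : v ∈ₛ V
    v∈V = let _ , _ , (v∈V , _) , _ = exchange in v∈V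
    v∉W : v ∉ₛ W
    v∉W = let _ , _ , (_ , v∉W) , _ = exchange in v∉W
    w∈W : w ∈ₛ W
    w∈W = let _ , _ , _ , (w∈W , _) , _ = exchange in w∈W
    w∉V : w ∉ₛ V
    w∉V = let _ , _ , _ , (_ , w∉V) , _ = exchange in w∉V
    V-v≢W-w : V - v ≢ W - w
    V-v≢W-w = let _ , _ , _ , _ , V-v≢W-w = exchange in V-v≢W-w

    v≢w : v ≢ w
    v≢w v≡w = w∉V (subst (_∈ₛ V) v≡w v∈V)

    w′ : Fin (1 ℕ.+ r)
    w′ = punchOut v≢w

    rest : Fin r → Fin (2 ℕ.+ r)
    rest = punchIn v ∘ punchIn w′

    -- Puts `v` and `w` in the pivot positions. As `v` lies in `V` only and `w` in `W` only, each of
    -- the two sums contains exactly its own pivot.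
    reordered : Fin (2 ℕ.+ r) → Fin (2 ℕ.+ r)
    reordered = v ∷ (punchIn v ∘ (w′ ∷ punchIn w′))

    reordered-injective : Injective _≡_ _≡_ reordered
    reordered-injective = ∷-injective
      (λ eq → ∷-injective (Fin.punchIn-injective w′ _ _) (λ q → Fin.punchInᵢ≢i w′ q ∘ sym) (Fin.punchIn-injective v _ _ eq))
      (λ q → Fin.punchInᵢ≢i v _ ∘ sym)

    rest-surjective : ∀ {x} → x ≢ v → x ≢ w → ∃[ t ] rest t ≡ x
    rest-surjective {x} x≢v x≢w = punchOut w′≢x′ , trans (cong (punchIn v) (Fin.punchIn-punchOut w′≢x′)) (Fin.punchIn-punchOut (x≢v ∘ sym))
      where
      w′≢x′ : w′ ≢ punchOut (x≢v ∘ sym)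
      w′≢x′ eq = x≢w (sym (Fin.punchOut-injective v≢w (x≢v ∘ sym) eq))

    sum-reordered : (f : Fin (2 ℕ.+ r) → ℕ) → sum f ≡ f v ℕ.+ (f w ℕ.+ sum (f ∘ rest))
    sum-reordered f = trans (ℕΣ.sum-remove {i = v} f) (cong (f v ℕ.+_) (trans (ℕΣ.sum-remove {i = w′} (f ∘ punchIn v))
      (cong (λ x → f x ℕ.+ sum (f ∘ rest)) (Fin.punchIn-punchOut v≢w))))

    V′ W′ : Vector Bool r
    V′ t = does (rest t ∈? V)
    W′ t = does (rest t ∈? W)

    -- Of the three elements of `V` only the pivot `v` is lost; `w` was never among them.
    V-ones : 2 ≤ sum (indicator ∘ V′)
    V-ones = ℕ.s≤s⁻¹ (subst (3 ≤_) (trans (card-sum V) (trans (sum-reordered (λ j → indicator (does (j ∈? V))))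
      (cong₂ (λ a b → indicator a ℕ.+ (indicator b ℕ.+ sum (indicator ∘ V′))) (dec-true (v ∈? V) v∈V) (dec-false (w ∈? V) w∉V)))) ∣V∣≥3)

    W-ones : 2 ≤ sum (indicator ∘ W′)
    W-ones = ℕ.s≤s⁻¹ (subst (3 ≤_) (trans (card-sum W) (trans (sum-reordered (λ j → indicator (does (j ∈? W))))
      (cong₂ (λ a b → indicator a ℕ.+ (indicator b ℕ.+ sum (indicator ∘ W′))) (dec-false (v ∈? W) v∉W) (dec-true (w ∈? W) w∈W)))) ∣W∣≥3)

    -- Neither `V - v` nor `W - w` contains `v` or `w`, so agreement on the remaining columns would
    -- make them equal.
    V′≢W′ : ∃[ t ] bit (V′ t) ≢ bit (W′ t)
    V′≢W′ = Fin.¬∀⟶∃¬ r _ (λ t → bit (V′ t) Fin.≟ bit (W′ t)) λ same → V-v≢W-w (⊆-antisym (forth same) (back same))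
      where
      transfer : ∀ {P Q : Set} (P? : Dec P) (Q? : Dec Q) → bit (does P?) ≡ bit (does Q?) → P → Q
      transfer (yes _) (yes q) _ _ = q
      transfer (no ¬p) _       _ p = contradiction p ¬p
      forth : (∀ t → bit (V′ t) ≡ bit (W′ t)) → ∀ {x} → x ∈ₛ V - v → x ∈ₛ W - w
      forth same {x} x∈V-v = x∈p∧x≢y⇒x∈p-y (subst (_∈ₛ W) rest≡x (transfer (rest p ∈? V) (rest p ∈? W) (same p) (subst (_∈ₛ V) (sym rest≡x) x∈V))) x≢w
        where
        x∈V : x ∈ₛ V
        x∈V = p─q⊆p V ⁅ v ⁆ x∈V-v
        x≢w : x ≢ w
        x≢w refl = w∉V x∈V
        found = rest-surjective (λ { refl → x∉p-x V v x∈V-v }) x≢w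
        p = proj₁ found
        rest≡x = proj₂ found
      back : (∀ t → bit (V′ t) ≡ bit (W′ t)) → ∀ {x} → x ∈ₛ W - w → x ∈ₛ V - v
      back same {x} x∈W-w = x∈p∧x≢y⇒x∈p-y (subst (_∈ₛ V) rest≡x (transfer (rest p ∈? W) (rest p ∈? V) (sym (same p)) (subst (_∈ₛ W) (sym rest≡x) x∈W))) x≢v
        where
        x∈W : x ∈ₛ W
        x∈W = p─q⊆p W ⁅ w ⁆ x∈W-w
        x≢v : x ≢ v
        x≢v refl = v∉W x∈W
        found = rest-surjective x≢v (λ { refl → x∉p-x W w x∈W-w })
        p = proj₁ found
        rest≡x = proj₂ found

    columnSum-reordered : ∀ (U : Subset (2 ℕ.+ r)) i → let A = selectColumns B c in
      columnSum A U i ≡ bit (does (v ∈? U)) ⊗ A i v ⊕ (bit (does (w ∈? U)) ⊗ A i w ⊕ dot (λ t → bit (does (rest t ∈? U))) (A i ∘ rest))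
    columnSum-reordered U i = trans (cong (_mod 2) (sum-reordered term)) (trans (mod2-+ (term v) _)
      (cong₂ _⊕_ (mod2-term v) (trans (mod2-+ (term w) _) (cong₂ _⊕_ (mod2-term w) (mod2-dot (λ t → does (rest t ∈? U)) (λ t → B i (c (rest t))))))))
      where
      term : Fin (2 ℕ.+ r) → ℕ
      term j = if does (j ∈? U) then toℕ (B i (c j)) else 0
      mod2-term : ∀ j → term j mod 2 ≡ bit (does (j ∈? U)) ⊗ B i (c j)
      mod2-term j = branches (does (j ∈? U))
        where
        branches : ∀ b → (if b then toℕ (B i (c j)) else 0) mod 2 ≡ bit b ⊗ B i (c j)
        branches true  = mod2-toℕ (B i (c j))
        branches false = refl

  suitablePair⇒selection : Selection B r
  suitablePair⇒selection = record
    { column            = c ∘ reordered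
    ; column-injective  = reordered-injective ∘ c-injective
    ; V                 = bit ∘ V′
    ; W                 = bit ∘ W′
    ; V-twoOnes         = twoOnesOf V′ V-ones
    ; W-twoOnes         = twoOnesOf W′ W-ones
    ; V≢W               = V′≢W′
    ; sums-uncorrelated = uncorrelated-cong columnSums (orthogonal⇒uncorrelated _ _ orthogonal)
    }
    where
    A = selectColumns B c
    columnSums : ∀ i p → (columnSum A V i ∷ columnSum A W i ∷ []) p ≡ sums (selectColumns B (c ∘ reordered)) (bit ∘ V′) (bit ∘ W′) i p
    columnSums i zero = trans (columnSum-reordered V i)
      (cong₂ (λ a b → bit a ⊗ A i v ⊕ (bit b ⊗ A i w ⊕ dot (bit ∘ V′) (A i ∘ rest))) (dec-true (v ∈? V) v∈V) (dec-false (w ∈? V) w∉V))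
    columnSums i (suc zero) = trans (columnSum-reordered W i) (trans
      (cong₂ (λ a b → bit a ⊗ A i v ⊕ (bit b ⊗ A i w ⊕ dot (bit ∘ W′) (A i ∘ rest))) (dec-false (v ∈? W) v∉W) (dec-true (w ∈? W) w∈W))
      (cong (λ x → A i x ⊕ dot (bit ∘ W′) (A i ∘ rest)) (sym (Fin.punchIn-punchOut v≢w))))

-- `e` counts the columns added to the given eight: k = e + 8, and e + 6 = k - 2. The inequality is
-- strict because the Hadamard array has 4ℓ - 1 columns.
conjecture⇒design : HadamardConjecture → ∀ ℓ → Odd ℓ → 3 ≤ ℓ → ∀ e → e ℕ.+ 8 ℕ.< 4 * ℓ →
                    FactorialDesign (2 ℕ.+ (e ℕ.+ 6)) (4 * ℓ) (2 ^ (e ℕ.+ 6)) 2 2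
conjecture⇒design conjecture (suc ℓ) odd 3≤ℓ e e+8<4ℓ =
  let H , hadamard , normalized , c , c-injective , _ , V , W , suitable = conjecture (suc ℓ) odd 3≤ℓ in
  selection⇒design (hadamardArray-uncorrelated hadamard normalized)
    (insertColumns e (ℕ.s≤s⁻¹ e+8<4ℓ) (suitablePair⇒selection {ℓ = suc ℓ} c-injective suitable))

-- The parity obstruction

triple : Vector (Fin 2) 3 → ℤ
triple u = χ (u zero) ℤ.* (χ (u (suc zero)) ℤ.* χ (u (suc (suc zero))))

private
  0³ : Vector (Fin 2) 3
  0³ _ = zero

-- In the Fourier expansion of the indicator of 0 strength 2 kills weights 1 and 2, leaving the
-- constant and the triple product.
zeroFrequency : {A : Matrix (Fin 2) n 3} → Uncorrelated A →
                + (count (λ i → A i ≗? 0³) * 8) ≡ + n ℤ.+ sumℤ (triple ∘ A)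
zeroFrequency {n} {A} u = begin
  + (sum I * 8)                              ≡⟨ ℤ.pos-* (sum I) 8 ⟩
  + sum I ℤ.* + 8                            ≡⟨ cong (ℤ._* + 8) (pos-sum I) ⟩
  sumℤ (+_ ∘ I) ℤ.* + 8                      ≡⟨ ℤΣ.*-distribʳ-sum (+ 8) (+_ ∘ I) ⟩
  sumℤ (λ i → + I i ℤ.* + 8)                 ≡⟨ ℤΣ.sum-cong-≗ (λ i → indicator₃ (A i zero) (A i (suc zero)) (A i (suc (suc zero)))) ⟩
  sumℤ (λ i → 1ℤ ℤ.+ (x i ℤ.+ (y i ℤ.+ (z i ℤ.+ (x i ℤ.* y i ℤ.+ (x i ℤ.* z i ℤ.+ (y i ℤ.* z i ℤ.+ triple (A i))))))))
    ≡⟨ trans (sumℤ-+ {n} (λ _ → 1ℤ) _) (cong₂ ℤ._+_ (trans (sumℤ-const n 1ℤ) (ℤ.*-identityʳ (+ n)))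
       (drop x (single u zero) (drop y (single u (suc zero)) (drop z (single u (suc (suc zero)))
       (drop (λ i → x i ℤ.* y i) (pair u {zero} {suc zero} λ ())
       (drop (λ i → x i ℤ.* z i) (pair u {zero} {suc (suc zero)} λ ())
       (drop (λ i → y i ℤ.* z i) (pair u {suc zero} {suc (suc zero)} λ ()) refl))))))) ⟩
  + n ℤ.+ sumℤ (triple ∘ A)                  ∎
  where
  open ≡-Reasoning
  I : Vector ℕ n
  I i = indicator (does (A i ≗? 0³))
  x y z : Vector ℤ n
  x i = χ (A i zero)
  y i = χ (A i (suc zero))
  z i = χ (A i (suc (suc zero)))
  drop : (f : Vector ℤ n) {g : Vector ℤ n} {s : ℤ} → sumℤ f ≡ 0ℤ → sumℤ g ≡ s → sumℤ (λ i → f i ℤ.+ g i) ≡ s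
  drop f Σf≡0 Σg≡s = trans (sumℤ-+ f _) (trans (cong₂ ℤ._+_ Σf≡0 Σg≡s) (ℤ.+-identityˡ _))
  indicator₃ : ∀ a b c →
    + indicator (does (a Fin.≟ zero) ∧ (does (b Fin.≟ zero) ∧ (does (c Fin.≟ zero) ∧ true))) ℤ.* + 8 ≡
    1ℤ ℤ.+ (χ a ℤ.+ (χ b ℤ.+ (χ c ℤ.+ (χ a ℤ.* χ b ℤ.+ (χ a ℤ.* χ c ℤ.+ (χ b ℤ.* χ c ℤ.+ χ a ℤ.* (χ b ℤ.* χ c)))))))
  indicator₃ zero       zero       zero       = refl
  indicator₃ zero       zero       (suc zero) = refl
  indicator₃ zero       (suc zero) zero       = refl
  indicator₃ zero       (suc zero) (suc zero) = refl
  indicator₃ (suc zero) zero       zero       = refl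
  indicator₃ (suc zero) zero       (suc zero) = refl
  indicator₃ (suc zero) (suc zero) zero       = refl
  indicator₃ (suc zero) (suc zero) (suc zero) = refl

-- Correlation 0 means that two rows agree in exactly one of the three coordinates; the two sign
-- changes cancel in the product.
triple-constant : {A : Matrix (Fin 2) 4 3} → Uncorrelated A → ∀ i j → triple (A i) ≡ triple (A j)
triple-constant {A} u i j with i Fin.≟ j
... | yes refl = refl
... | no  i≢j  = uncorrelated⇒same (A i zero) (A i (suc zero)) (A i (suc (suc zero))) (A j zero) (A j (suc zero)) (A j (suc (suc zero)))
                   (saturated⇒correlation≡0 u i≢j)
  where
  uncorrelated⇒same : ∀ a b c a′ b′ c′ →
    1ℤ ℤ.+ (χ a ℤ.* χ a′ ℤ.+ (χ b ℤ.* χ b′ ℤ.+ (χ c ℤ.* χ c′ ℤ.+ 0ℤ))) ≡ 0ℤ →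
    χ a ℤ.* (χ b ℤ.* χ c) ≡ χ a′ ℤ.* (χ b′ ℤ.* χ c′)
  uncorrelated⇒same = from-yes (Fin.all? λ a → Fin.all? λ b → Fin.all? λ c → Fin.all? λ a′ → Fin.all? λ b′ → Fin.all? λ c′ →
    (1ℤ ℤ.+ (χ a ℤ.* χ a′ ℤ.+ (χ b ℤ.* χ b′ ℤ.+ (χ c ℤ.* χ c′ ℤ.+ 0ℤ))) ℤ.≟ 0ℤ) →-dec
    (χ a ℤ.* (χ b ℤ.* χ c) ℤ.≟ χ a′ ℤ.* (χ b′ ℤ.* χ c′)))

-- In each column all four vectors have the same parity, hence every row contains the zero vector
-- equally often, namely c / 2 times.
no-design-3-4-4c : ∀ c → Odd c → ¬ FactorialDesign 3 4 (4 * c) 2 2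
no-design-3-4-4c c odd (D , d) = odd (divides N₀ (ℕ.*-cancelˡ-≡ c (N₀ * 2) 16 (begin
  16 * c                                                    ≡⟨ ℕ.*-assoc 4 4 c ⟩
  4 * (4 * c)                                               ≡⟨ IsFactorialDesign.uniform d 0³ ⟨
  sum N * 8                                                 ≡⟨ cong (_* 8) (ℕΣ.sum-cong-≗ N-constant) ⟩
  sum {4} (λ _ → N₀) * 8                                    ≡⟨ cong (_* 8) (sum-const 4 N₀) ⟩
  4 * N₀ * 8                                                ≡⟨ regroup N₀ ⟩
  16 * (N₀ * 2)                                             ∎)))
  where
  open ≡-Reasoning
  N : Fin 4 → ℕ
  N i = count (λ j → D i j ≗? 0³)
  N₀ = N zero
  row : ∀ i → Uncorrelated (λ j → D i j)
  row i = isOA⇒uncorrelated (IsFactorialDesign.rows d i)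
  N-constant : ∀ i → N i ≡ N₀
  N-constant i = ℕ.*-cancelʳ-≡ (N i) N₀ 8 (ℤ.+-injective (trans (zeroFrequency (row i)) (trans
    (cong (ℤ._+_ (+ (4 * c))) (ℤΣ.sum-cong-≗ (λ j → triple-constant (isOA⇒uncorrelated (IsFactorialDesign.columns d j)) i zero)))
    (sym (zeroFrequency (row zero))))))
  regroup : ∀ x → 4 * x * 8 ≡ 16 * (x * 2)
  regroup = ℕSolver.solve-∀

exceptional⇒no-design : (k , m , n , 2 , 2) ∈ Exceptional → ¬ FactorialDesign k m n 2 2
exceptional⇒no-design (c , odd , inj₁ refl) D = no-design-3-4-4c c odd (transposed D)
exceptional⇒no-design (c , odd , inj₂ refl) D = no-design-3-4-4c c odd D

design⇒admissible : Fin m → Fin n → FactorialDesign k m n 2 2 → (k , m , n , 2 , 2) ∈ Admissible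
design⇒admissible i j (D , d) =
  divides (sum (λ i → count (λ j → D i j ≗? (λ _ → zero)))) (sym (IsFactorialDesign.uniform d (λ _ → zero))) ,
  (_ , IsFactorialDesign.columns d j) , (_ , IsFactorialDesign.rows d i)

-- Divisibility of the parameters and the case distinction

odd⇒1⊎≥3 : ∀ m → Odd m → m ≡ 1 ⊎ ∃[ j ] m ≡ 3 ℕ.+ 2 * j
odd⇒1⊎≥3 zero          odd = contradiction (divides 0 refl) odd
odd⇒1⊎≥3 (suc zero)    odd = inj₁ refl
odd⇒1⊎≥3 (suc (suc m)) odd with odd⇒1⊎≥3 m (λ 2∣m → odd (∣m∣n⇒∣m+n (divides 1 refl) 2∣m))
... | inj₁ refl       = inj₂ (0 , refl)
... | inj₂ (j , refl) = inj₂ (suc j , cong (3 ℕ.+_) (sym (ℕ.*-suc 2 j)))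

odd-* : ∀ m n → Odd m → Odd n → Odd (m * n)
odd-* m n odd-m odd-n 2∣mn = [ odd-m , odd-n ]′ (euclidsLemma m n prime[2] 2∣mn)

2^k∣2^s*odd⇒k≤s : ∀ k s {o} → Odd o → 2 ^ k ∣ 2 ^ s * o → k ≤ s
2^k∣2^s*odd⇒k≤s zero    s       odd 2^k∣ = z≤n
2^k∣2^s*odd⇒k≤s (suc k) zero    {o} odd 2^k∣ = contradiction (subst (2 ∣_) (ℕ.*-identityˡ o) (∣-trans (m∣m*n (2 ^ k)) 2^k∣)) odd
2^k∣2^s*odd⇒k≤s (suc k) (suc s) {o} odd 2^k∣ =
  s≤s (2^k∣2^s*odd⇒k≤s k s odd (*-cancelˡ-∣ 2 (subst (2 * 2 ^ k ∣_) (ℕ.*-assoc 2 (2 ^ s) o) 2^k∣)))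

2^s∣2^a*b : ∀ {s a} b → s ≤ a → 2 ^ s ∣ 2 ^ a * b
2^s∣2^a*b {s} {a} b s≤a = ∣m⇒∣m*n b (subst (λ x → 2 ^ s ∣ 2 ^ x) (ℕ.m+[n∸m]≡n s≤a)
  (subst (2 ^ s ∣_) (sym (ℕ.^-distribˡ-+-* 2 s (a ℕ.∸ s))) (m∣m*n (2 ^ (a ℕ.∸ s)))))

repeatedRows : ∀ m′ → .{{ℕ.NonZero m′}} → m ∣ m′ → FactorialDesign k m n 2 2 → FactorialDesign k m′ n 2 2
repeatedRows {k = k} {n = n} (suc _) (divides (suc c) m′≡c*m) D =
  subst (λ m → FactorialDesign k m n 2 2) (sym m′≡c*m) (repeated c D)

repeatedColumns : ∀ n′ → .{{ℕ.NonZero n′}} → n ∣ n′ → FactorialDesign k m n 2 2 → FactorialDesign k m n′ 2 2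
repeatedColumns n′ n∣n′ D = transposed (repeatedRows n′ n∣n′ (transposed D))

-- One block of 12 rows settles 4m modulo 8, blocks of 8 do the rest. Blocks of 4 rows would
-- restrict k to 3.
rows-4m : ∀ j → FactorialDesign k 12 n 2 2 → FactorialDesign k 8 n 2 2 → FactorialDesign k (4 * (3 ℕ.+ 2 * j)) n 2 2
rows-4m             zero    D₁₂ D₈ = D₁₂
rows-4m {k} {n} (suc j) D₁₂ D₈ =
  subst (λ m → FactorialDesign k m n 2 2) (regroup j) (stacked D₁₂ (repeated j D₈))
  where
  regroup : ∀ j → 12 ℕ.+ suc j * 8 ≡ 4 * (3 ℕ.+ 2 * suc j)
  regroup = ℕSolver.solve-∀

-- Cutting both dimensions leaves blocks 12 × 12, 12 × 8, 8 × 12 and 8 × 8. Only the first needs a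
-- table of its own: 2 ^ 5 does not divide 144, so it cannot come from five factors.
design-4m-4b : ∀ j l → FactorialDesign 4 (4 * (3 ℕ.+ 2 * j)) (4 * (3 ℕ.+ 2 * l)) 2 2
design-4m-4b j l = transposed (rows-4m l
  (transposed (rows-4m j design-4-12-12 (transposed twelve)))
  (transposed (rows-4m j twelve eight)))
  where
  twelve = withoutFirstFactor (s≤s (s≤s z≤n)) Twelve.factors-5
  eight  = withoutFirstFactor (s≤s (s≤s z≤n)) Eight.factors-5

-- The case m = 1, where four rows leave only k = 3: width 4b is exceptional, and a multiple of 8
-- repeats the 4 × 8 design.
few-rows : ∀ b → Odd b → ∀ a → .{{ℕ.NonZero (2 ^ a * b)}} → 2 ≤ a → ∀ k → 3 ℕ.+ k ℕ.< 4 →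
           (3 ℕ.+ k , 4 , 2 ^ a * b , 2 , 2) ∉ Exceptional → FactorialDesign (3 ℕ.+ k) 4 (2 ^ a * b) 2 2
few-rows b odd 1                   (s≤s ()) _    _ _
few-rows b odd 2                   _        zero _ ∉exc = contradiction (b , odd , inj₂ refl) ∉exc
few-rows b odd (suc (suc (suc a))) _        zero _ _    = repeatedColumns _ (2^s∣2^a*b {3} {suc (suc (suc a))} b (s≤s (s≤s (s≤s z≤n)))) design-3-4-8
few-rows b odd _ _ (suc k) (s≤s (s≤s (s≤s (s≤s ()))))

-- The case a = 2, m ≥ 3, where divisibility caps k at 4. For b = 1 Rao's bound leaves k = 3, which
-- is exceptional; for b ≥ 3 the blocks apply.
few-columns : ∀ j → Odd (3 ℕ.+ 2 * j) → ∀ b → Odd b → ∀ k → 3 ℕ.+ k ≤ 4 → 3 ℕ.+ k ℕ.< 4 * b →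
              (3 ℕ.+ k , 4 * (3 ℕ.+ 2 * j) , 4 * b , 2 , 2) ∉ Exceptional →
              FactorialDesign (3 ℕ.+ k) (4 * (3 ℕ.+ 2 * j)) (4 * b) 2 2
few-columns j odd-m b odd-b k k≤4 k<4b ∉exc with odd⇒1⊎≥3 b odd-b
few-columns j odd-m b odd-b 0 _ _ ∉exc | inj₁ refl = contradiction (3 ℕ.+ 2 * j , odd-m , inj₁ refl) ∉exc
few-columns j odd-m b odd-b 0 _ _ _    | inj₂ (l , refl) = withoutFirstFactor (s≤s (s≤s z≤n)) (design-4m-4b j l)
few-columns j odd-m b odd-b 1 _ _ _    | inj₂ (l , refl) = design-4m-4b j l
few-columns j odd-m b odd-b (suc k) _ (s≤s (s≤s (s≤s (s≤s ())))) _ | inj₁ refl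
few-columns j odd-m b odd-b (suc (suc k)) (s≤s (s≤s (s≤s (s≤s ())))) _ _ | inj₂ _

-- From k = 5 on the base design has 2 ^ (k - 2) columns, a divisor of 2 ^ a * b because k ≤ 2 + a;
-- smaller k drop factors from k = 5.
many-columns : HadamardConjecture → ∀ j → Odd (3 ℕ.+ 2 * j) → ∀ b a → .{{ℕ.NonZero (2 ^ a * b)}} → 3 ≤ a →
               ∀ k → 3 ℕ.+ k ≤ 2 ℕ.+ a → 3 ℕ.+ k ℕ.< 4 * (3 ℕ.+ 2 * j) →
               FactorialDesign (3 ℕ.+ k) (4 * (3 ℕ.+ 2 * j)) (2 ^ a * b) 2 2
many-columns conjecture j odd b a 3≤a k k≤a k<4m = go k k≤a k<4m
  where
  design₅ : FactorialDesign 5 (4 * (3 ℕ.+ 2 * j)) (2 ^ a * b) 2 2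
  design₅ = repeatedColumns _ (2^s∣2^a*b b 3≤a) (rows-4m j Twelve.factors-5 Eight.factors-5)
  go : ∀ k → 3 ℕ.+ k ≤ 2 ℕ.+ a → 3 ℕ.+ k ℕ.< 4 * (3 ℕ.+ 2 * j) → FactorialDesign (3 ℕ.+ k) (4 * (3 ℕ.+ 2 * j)) (2 ^ a * b) 2 2
  go 0 _ _ = withoutFirstFactor (s≤s (s≤s z≤n)) (withoutFirstFactor (s≤s (s≤s z≤n)) design₅)
  go 1 _ _ = withoutFirstFactor (s≤s (s≤s z≤n)) design₅
  go 2 _ _ = design₅
  go 3 k≤a _ = repeatedColumns _ (2^s∣2^a*b b (ℕ.s≤s⁻¹ (ℕ.s≤s⁻¹ k≤a))) (rows-4m j Twelve.factors-6 Eight.factors-6)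
  go 4 k≤a _ = repeatedColumns _ (2^s∣2^a*b b (ℕ.s≤s⁻¹ (ℕ.s≤s⁻¹ k≤a))) (rows-4m j Twelve.factors-7 Eight.factors-7)
  go (suc (suc (suc (suc (suc e))))) k≤a k<4m =
    subst (λ k → FactorialDesign (2 ℕ.+ k) (4 * (3 ℕ.+ 2 * j)) (2 ^ a * b) 2 2) (ℕ.+-comm e 6)
      (repeatedColumns _ (2^s∣2^a*b b (subst (_≤ a) (ℕ.+-comm 6 e) (ℕ.s≤s⁻¹ (ℕ.s≤s⁻¹ k≤a))))
        (conjecture⇒design conjecture (3 ℕ.+ 2 * j) odd (ℕ.m≤m+n 3 (2 * j)) e
          (subst (ℕ._< 4 * (3 ℕ.+ 2 * j)) (ℕ.+-comm 8 e) k<4m)))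

-- Admissibility enters as inequalities: 2 ≤ a from 4 ∣ 2 ^ a * b, k ≤ 2 + a from comparing powers
-- of 2, the strict bounds from Rao.
design-exists : HadamardConjecture → ∀ m b → Odd m → Odd b → ∀ a → .{{ℕ.NonZero (4 * m)}} → .{{ℕ.NonZero (2 ^ a * b)}} →
  2 ≤ a → ∀ k → 2 ≤ k → k ≤ 2 ℕ.+ a → k ℕ.< 4 * m → k ℕ.< 2 ^ a * b →
  (k , 4 * m , 2 ^ a * b , 2 , 2) ∉ Exceptional → FactorialDesign k (4 * m) (2 ^ a * b) 2 2
design-exists _ m b _ _ a 2≤a 1 (s≤s ()) _ _ _ _
design-exists _ m b _ _ a 2≤a 2 _ _ _ _ _ =
  repeatedRows _ (m∣m*n m) (repeatedColumns _ (2^s∣2^a*b b 2≤a) design-2-4-4)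
design-exists conjecture m b odd-m odd-b a 2≤a (suc (suc (suc k))) _ k≤2+a k<4m k<n ∉exc
  with odd⇒1⊎≥3 m odd-m | ℕ.m≤n⇒m<n∨m≡n 2≤a
... | inj₁ refl       | _         = few-rows b odd-b a 2≤a k k<4m ∉exc
... | inj₂ (j , refl) | inj₂ refl = few-columns j odd-m b odd-b k k≤2+a k<n ∉exc
... | inj₂ (j , refl) | inj₁ 3≤a  = many-columns conjecture j odd-m b a 3≤a k k≤2+a k<4m

isOA⇒4∣size : {A : Matrix (Fin 2) n k} → IsOA n k 2 2 A → 4 ∣ n
isOA⇒4∣size {A = A} oa = divides (count (λ i → selectColumns A firstTwo i ≗? (λ _ → zero)))
  (sym (IsOA.balanced oa firstTwo (Fin.inject≤-injective (IsOA.t≤k oa) (IsOA.t≤k oa) _ _) (λ _ → zero)))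
  where
  firstTwo : Fin 2 → Fin _
  firstTwo p = inject≤ p (IsOA.t≤k oa)

theorem8 : HadamardConjecture →
    (m b : ℕ) → Odd m → Odd b → (a k : ℕ) →
    FactorialDesign k (4 * m) (2 ^ a * b) 2 2 ⇔
    ((k , 4 * m , 2 ^ a * b , 2 , 2) ∈ Admissible × (k , 4 * m , 2 ^ a * b , 2 , 2) ∉ Exceptional)
theorem8 conjecture zero    b odd-m odd-b a k = contradiction (divides 0 refl) odd-m
theorem8 conjecture (suc m) b odd-m odd-b a k = mk⇔
  (λ D → design⇒admissible zero j₀ D , λ exc → exceptional⇒no-design exc D)
  λ ((2^k∣mn , (A , oaA) , (B , oaB)) , ∉exc) → design-exists conjecture (suc m) b odd-m odd-b a
    (2^k∣2^s*odd⇒k≤s 2 a odd-b (isOA⇒4∣size oaB))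
    k (IsOA.t≤k oaA)
    (2^k∣2^s*odd⇒k≤s k (2 ℕ.+ a) (odd-* (suc m) b odd-m odd-b) (subst (2 ^ k ∣_) (regroup (suc m) (2 ^ a) b) 2^k∣mn))
    (degree<size (isOA⇒uncorrelated oaA) zero)
    (degree<size (isOA⇒uncorrelated oaB) j₀)
    ∉exc
  where
  instance
    b≢0 : ℕ.NonZero b
    b≢0 = ℕ.≢-nonZero λ { refl → odd-b (divides 0 refl) }
    n≢0 : ℕ.NonZero (2 ^ a * b)
    n≢0 = ℕ.m*n≢0 (2 ^ a) b {{ℕ.m^n≢0 2 a}}
  -- An index is where Rao's bound starts, and it picks the column of a design that serves as an
  -- array with 4m rows.
  j₀ : Fin (2 ^ a * b)
  j₀ = fromℕ< (ℕ.>-nonZero⁻¹ (2 ^ a * b))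
  regroup : ∀ m x b → 4 * m * (x * b) ≡ 2 * (2 * x) * (m * b)
  regroup = ℕSolver.solve-∀
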